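{- Let $\sigma_w=\{v\in\mathbb{F}_2^n:\mathrm{wt}(v)=w\}$ be the Hamming sphere of radius $w$ in $\mathbb{F}_2^n$, and let $t$ be a positive integer. A set $D\subseteq\sigma_w$ is a $t$-design if and only if $\sum_{v\in D}Q(v)=0$ for all $Q\in\bigcup_{d=1}^t\mathcal{D}_d^0$, where $\mathcal{D}_d^0$ is the space of degree-$d$ discrete harmonic polynomials on $\mathbb{F}_2^n$.
   Context: $\mathrm{wt}(v)$ is the number of nonzero coordinates of $v$. A $t$-$(n,w,\lambda)$-design is a (possibly empty) collection $D$ of distinct $w$-element subsets of $\{1,\dots,n\}$ such that $|\{S'\in D: S\subseteq S'\}|=\lambda$ for every $S\subset\{1,\dots,n\}$ with $|S|=t$; a $t$-design is a $t$-$(n,w,\lambda)$-design for some $\lambda$. Subsets $S'$ of $\{1,\dots,n\}$ of size $w$ are identified with their indicator vectors in $\sigma_w$, so a subset of $\sigma_w$ can be a $t$-design. Discrete harmonic polynomials: functions $\mathbb{F}_2^n\to\mathbb{C}$ are identified with elements of $(\mathbb{C}^2)^{\otimes n}$, the pure tensor $\binom{g_{10}}{g_{11}}\otimes\cdots\otimes\binom{g_{n0}}{g_{n1}}$ being the function $v\mapsto g_{1v_1}\cdots g_{nv_n}$. Let $\mathcal{D}_d$ be the complex span of the functions $v\mapsto\prod_{j\in J}(-1)^{v_j}$ with $J\subseteq\{1,\dots,n\}$, $|J|=d$ (with $\mathcal{D}_d=\{0\}$ for $d<0$). Let $X'=\tfrac12\begin{pmatrix}1&-1\\1&-1\end{pmatrix}$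 and $\tilde X'=\sum_{j=1}^n I\otimes\cdots\otimes X'\otimes\cdots\otimes I$ ($X'$ in the $j$-th factor, the $2\times2$ identity matrix $I$ in the others). Then $\tilde X'$ maps $\mathcal{D}_d$ to $\mathcal{D}_{d-1}$, and $\mathcal{D}_d^0:=\ker(\tilde X':\mathcal{D}_d\to\mathcal{D}_{d-1})$ is the space of degree-$d$ discrete harmonic polynomials.
   Formalization: The formal theorem adds t ≤ w: for t > w every D ⊆ σ_w is trivially a t-design, and the claim fails, e.g. for n=2, w=1, t=2, D={{1}} with Q=(-1)^{v_1}-(-1)^{v_2}. It is proved over every field of characteristic zero in place of ℂ. -}

module Defs where

open import Level using (Level; _⊔_)
open import Algebra.Apartness.Bundles using (HeytingField; HeytingCommutativeRing)
open import Algebra.Bundles using (CommutativeRing)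
import Algebra.Definitions.RawMonoid as RawMonoidDefs
open import Data.Bool.Base using (Bool; true; false; if_then_else_)
open import Data.Fin.Base using (Fin)
open import Data.Fin.Subset using (Subset; inside; outside; ∣_∣; _⊆_)
open import Data.Fin.Subset.Properties using (_⊆?_; _∈?_)
open import Data.List.Base using (List; []; _∷_; _++_; map; foldr; filter; length; allFin)
open import Data.List.Relation.Unary.All using (All)
open import Data.List.Relation.Unary.Unique.Propositional using (Unique)
open import Data.Nat.Base using (ℕ; zero; suc)
import Data.Nat.Properties as ℕ
open import Data.Product.Base using (_×_; Σ-syntax; ∃-syntax; proj₁)
open import Data.Vec.Base using (Vec; []; _∷_; lookup; replicate; _[_]≔_)
open import Relation.Binary.PropositionalEquality using (_≡_)
open import Relation.Unary using (Pred)

-- `Subset n` is definitionally `Vec Bool n` (true = inside), so it is at once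
-- the type of subsets of {1,…,n} and of their indicator vectors in 𝔽₂ⁿ.
𝔽₂^_ : ℕ → Set
𝔽₂^ n = Subset n

wt : ∀ {n} → 𝔽₂^ n → ℕ
wt v = ∣ v ∣

σ : ∀ {n} → ℕ → Pred (𝔽₂^ n) _
σ w v = wt v ≡ w

-- A finite set of subsets is a duplicate-free list of them.
-- For t > w every set of w-subsets is a design with lam = 0, which is why the
-- characterisation of designs is stated under t ≤ w.
record IsDesign (t n w lam : ℕ) (D : List (Subset n)) : Set where
  field
    distinct : Unique D
    blocks   : All (λ S′ → ∣ S′ ∣ ≡ w) D
    balanced : ∀ (S : Subset n) → ∣ S ∣ ≡ t → length (filter (S ⊆?_) D) ≡ lam

IsTDesign : (t n w : ℕ) → List (Subset n) → Set
IsTDesign t n w D = ∃[ lam ] IsDesign t n w lam D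

cube : ∀ n → List (𝔽₂^ n)
cube zero    = [] ∷ []
cube (suc n) = map (outside ∷_) (cube n) ++ map (inside ∷_) (cube n)

-- The image of every positive integer is apart from 0, i.e. invertible.
-- (With classical logic this is the usual notion of characteristic zero.)
CharZero : ∀ {c ℓ₁ ℓ₂} → HeytingField c ℓ₁ ℓ₂ → Set ℓ₂
CharZero K = ∀ n → (suc n ×ₙ 1#) # 0#
  where
  open HeytingField K
  open HeytingCommutativeRing heytingCommutativeRing using (commutativeRing)
  open CommutativeRing commutativeRing using (+-rawMonoid)
  open RawMonoidDefs +-rawMonoid renaming (_×_ to _×ₙ_)

-- K stands for ℂ, which is one such field.
module DiscreteHarmonic
  {c ℓ₁ ℓ₂ : Level} (K : HeytingField c ℓ₁ ℓ₂) (charZero : CharZero K) where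

  open HeytingField K

  ∑ : ∀ {a} {A : Set a} → List A → (A → Carrier) → Carrier
  ∑ xs f = foldr (λ x s → f x + s) 0# xs

  ∏ : ∀ {a} {A : Set a} → List A → (A → Carrier) → Carrier
  ∏ xs f = foldr (λ x p → f x * p) 1# xs

  -- The inverse of 1 + (1 + 0) - 0.
  ½ : Carrier
  ½ = proj₁ (#⇒invertible (charZero 1))

  -1^_ : Bool → Carrier
  -1^ b = if b then - 1# else 1#

  Fun : ℕ → Set c
  Fun n = 𝔽₂^ n → Carrier

  χ : ∀ {n} → Subset n → Fun n
  χ {n} J v = ∏ (filter (_∈? J) (allFin n)) (λ j → -1^ (lookup v j))

  𝒟 : ∀ {n} → ℕ → Pred (Fun n) (c ⊔ ℓ₁)
  𝒟 {n} d Q = Σ[ coeff ∈ (Subset n → Carrier) ] ∀ v →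
    Q v ≈ ∑ (filter (λ J → ∣ J ∣ ℕ.≟ d) (cube n)) (λ J → coeff J * χ J v)

  -- M a b is the entry in row a and column b, with false, true standing for 0, 1.
  Mat₂ : Set c
  Mat₂ = Bool → Bool → Carrier

  I₂ : Mat₂
  I₂ false false = 1#
  I₂ false true  = 0#
  I₂ true  false = 0#
  I₂ true  true  = 1#

  X′ : Mat₂
  X′ _ false = ½ * 1#
  X′ _ true  = ½ * - 1#

  -- The (v , u) entry of the Kronecker product of the given matrices.
  entry : ∀ {n} → Vec Mat₂ n → 𝔽₂^ n → 𝔽₂^ n → Carrier
  entry []       []      []      = 1#
  entry (M ∷ Ms) (a ∷ v) (b ∷ u) = M a b * entry Ms v u

  -- The action of M₁ ⊗ ⋯ ⊗ Mₙ on (K²)^⊗ⁿ, whose elements are functions on 𝔽₂ⁿ: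
  -- it sends the pure tensor g₁ ⊗ ⋯ ⊗ gₙ to M₁g₁ ⊗ ⋯ ⊗ Mₙgₙ.
  ⨂ : ∀ {n} → Vec Mat₂ n → Fun n → Fun n
  ⨂ {n} Ms f v = ∑ (cube n) (λ u → entry Ms v u * f u)

  X̃′ : ∀ {n} → Fun n → Fun n
  X̃′ {n} f v = ∑ (allFin n) (λ j → ⨂ (replicate n I₂ [ j ]≔ X′) f v)

  -- For d = 0 the kernel condition is vacuous, X̃′ being zero on constants.
  𝒟⁰ : ∀ {n} → ℕ → Pred (Fun n) (c ⊔ ℓ₁)
  𝒟⁰ d Q = 𝒟 d Q × (∀ v → X̃′ Q v ≈ 0#)

-- On 𝒟 d the adjacency operator of the cube acts as n − 2d, so a harmonic Q of
-- degree d satisfies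
--   Σ_{j ∈ S} Q(S − j) = (∣S∣ − d) Q(S),   Σ_{j ∉ S} Q(S + j) = (n − ∣S∣ − d) Q(S).
-- Let N(S) be the number of blocks containing S and A_k = Σ_{∣S∣ = k} N(S) Q(S).
-- The first identity and double counting give (k + 1 − d) A_{k+1} = (w − k) A_k,
-- and A_w is the sum of Q over D. If D is a t-design, A_t is a multiple of
-- Σ_{∣S∣ = t} Q(S), which vanishes by the second identity.
--
-- Conversely let M(J) = Σ_{v ∈ D} χ_J(v). If M is constant on sets of size d and
-- d − 1, then c(J) = (n − d) M(J) − C has, for a suitable integer C, zero sum over
-- the sets J of size d + 1 above any set of size d, so Σ_J c(J) χ_J is harmonic and
-- its sum over D gives Σ_J c(J)² = 0. As c is integer valued, c = 0, that is, M is
-- constant on sets of size d + 1. Finally 2^∣J∣ N(J) = Σ_{A ⊆ J} (−1)^∣A∣ M(A).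
module Submission where

open import Defs
open import Algebra.Apartness.Bundles using (HeytingField; HeytingCommutativeRing)
open import Algebra.Bundles using (CommutativeRing)
import Algebra.Properties.AbelianGroup as AbelianGroupProperties
import Algebra.Properties.Ring as RingProperties
import Algebra.Properties.Semiring.Mult as Multᵤ
import Algebra.Properties.Semiring.Mult.TCOptimised as Mult
import Algebra.Solver.Ring as RingSolver
open import Algebra.Solver.Ring.AlmostCommutativeRing
  using (_-Raw-AlmostCommutative⟶_; fromCommutativeRing)
open import Data.Integer.Base as ℤ using (ℤ; -[1+_]; _⊖_)
import Data.Integer.Properties as ℤ
open import Data.Bool.Base using (true; false; if_then_else_)
open import Data.Fin.Base using (Fin; zero; suc)
open import Data.Fin.Subset using (Subset; inside; outside; ∣_∣)
open import Data.Fin.Subset.Properties using (_⊆?_; _∈?_; ∣p∣≤n; p⊆q⇒∣p∣≤∣q∣)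
open import Data.List.Base using (List; []; _∷_; _++_; map; filter; length; allFin)
open import Data.List.Properties using (map-tabulate)
open import Data.List.Relation.Unary.All as All using (All; []; _∷_)
open import Data.List.Relation.Unary.Unique.Propositional using (Unique)
open import Data.Maybe.Base using (Maybe; just; nothing)
open import Data.Nat.Base as ℕ using (ℕ; zero; suc; _≤_)
import Data.Nat.Properties as ℕ
open import Data.Product.Base using (_×_; ∃-syntax; _,_; proj₁; proj₂)
import Data.Sum.Base as Sum
open import Data.Vec.Base using (Vec; []; _∷_; lookup; replicate; _[_]≔_)
open import Function.Bundles using (_⇔_; mk⇔)
open import Function.Base using (_∘_; id)
open import Level using (Level)
open import Relation.Binary.PropositionalEquality as ≡ using (_≡_)
open import Relation.Nullary.Negation.Core using (contradiction)
open import Relation.Nullary.Decidable.Core using (Dec; yes; no; does)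

-- The canonical homomorphism from the integers to a commutative ring.

module IntegerMultiples {c ℓ} (R : CommutativeRing c ℓ) where
  open CommutativeRing R
  open AbelianGroupProperties +-abelianGroup using (⁻¹-∙-comm; ⁻¹-involutive)
  open RingProperties ring using (-0#≈0#; -‿distribˡ-*; -‿distribʳ-*)
  open Mult semiring using (×1-homo-*; ×-homo-+; 1+×) renaming (_×_ to _×ₙ_)
  open import Relation.Binary.Reasoning.Setoid setoid

  -- With the optimised multiple, ι (ℤ.+ 1) is definitionally 1#, so that the
  -- solver's constants match the literal 0# and 1# of a goal.
  μ : ℕ → Carrier
  μ n = n ×ₙ 1#

  ι : ℤ → Carrier
  ι (ℤ.+ n)    = μ n
  ι -[1+ n ] = - μ (suc n)

  μ-suc : ∀ n → μ (suc n) ≈ 1# + μ n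
  μ-suc n = 1+× n 1#

  μ-+ : ∀ m n → μ (m ℕ.+ n) ≈ μ m + μ n
  μ-+ = ×-homo-+ 1#

  ι-⊖ : ∀ m n → ι (m ⊖ n) ≈ μ m - μ n
  ι-⊖ m       zero    = sym (trans (+-congˡ -0#≈0#) (+-identityʳ _))
  ι-⊖ zero    (suc n) = sym (+-identityˡ _)
  ι-⊖ (suc m) (suc n) = begin
    ι (suc m ⊖ suc n)           ≡⟨ ≡.cong ι (ℤ.[1+m]⊖[1+n]≡m⊖n m n) ⟩
    ι (m ⊖ n)                   ≈⟨ ι-⊖ m n ⟩
    μ m - μ n                   ≈⟨ +-congʳ (+-identityʳ _) ⟨
    -- A cancelling pair is inserted so that each of the two multiples gains one `1#`.
    μ m + 0# - μ n              ≈⟨ +-congʳ (+-congˡ (-‿inverseʳ 1#)) ⟨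
    μ m + (1# - 1#) - μ n       ≈⟨ +-congʳ (+-assoc _ _ _) ⟨
    μ m + 1# - 1# - μ n         ≈⟨ +-assoc _ _ _ ⟩
    μ m + 1# + (- 1# - μ n)     ≈⟨ +-cong (+-comm _ _) (⁻¹-∙-comm _ _) ⟩
    1# + μ m - (1# + μ n)       ≈⟨ +-cong (μ-suc m) (-‿cong (μ-suc n)) ⟨
    μ (suc m) - μ (suc n)       ∎

  ι-neg : ∀ i → ι (ℤ.- i) ≈ - ι i
  ι-neg (ℤ.+ zero)  = sym -0#≈0#
  ι-neg (ℤ.+ suc n) = refl
  ι-neg -[1+ n ]  = sym (⁻¹-involutive _)

  ι-+ : ∀ i j → ι (i ℤ.+ j) ≈ ι i + ι j
  ι-+ (ℤ.+ m)    (ℤ.+ n)    = μ-+ m n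
  ι-+ (ℤ.+ m)    -[1+ n ] = ι-⊖ m (suc n)
  ι-+ -[1+ m ] (ℤ.+ n)    = trans (ι-⊖ n (suc m)) (+-comm _ _)
  ι-+ -[1+ m ] -[1+ n ] = begin
    - μ (suc (suc (m ℕ.+ n)))     ≈⟨ -‿cong (μ-suc (suc m ℕ.+ n)) ⟩
    - (1# + μ (suc m ℕ.+ n))      ≈⟨ -‿cong (+-congˡ (μ-+ (suc m) n)) ⟩
    - (1# + (μ (suc m) + μ n))    ≈⟨ -‿cong (+-assoc _ _ _) ⟨
    - (1# + μ (suc m) + μ n)      ≈⟨ -‿cong (+-congʳ (+-comm _ _)) ⟩
    - (μ (suc m) + 1# + μ n)      ≈⟨ -‿cong (+-assoc _ _ _) ⟩
    - (μ (suc m) + (1# + μ n))    ≈⟨ -‿cong (+-congˡ (μ-suc n)) ⟨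
    - (μ (suc m) + μ (suc n))     ≈⟨ ⁻¹-∙-comm _ _ ⟨
    - μ (suc m) - μ (suc n)       ∎

  ι-* : ∀ i j → ι (i ℤ.* j) ≈ ι i * ι j
  ι-* (ℤ.+ m) (ℤ.+ n) = trans (reflexive (≡.cong ι (ℤ.+◃n≡+n (m ℕ.* n)))) (×1-homo-* m n)
  ι-* (ℤ.+ m) -[1+ n ] = begin
    ι (ℤ.+ m ℤ.* -[1+ n ])     ≡⟨ ≡.cong ι (ℤ.-◃n≡-n (m ℕ.* suc n)) ⟩
    ι (ℤ.- ℤ.+ (m ℕ.* suc n))  ≈⟨ ι-neg (ℤ.+ (m ℕ.* suc n)) ⟩
    - μ (m ℕ.* suc n)        ≈⟨ -‿cong (×1-homo-* m (suc n)) ⟩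
    - (μ m * μ (suc n))      ≈⟨ -‿distribʳ-* _ _ ⟩
    μ m * - μ (suc n)        ∎
  ι-* -[1+ m ] (ℤ.+ n) = begin
    ι (-[1+ m ] ℤ.* ℤ.+ n)     ≡⟨ ≡.cong ι (ℤ.-◃n≡-n (suc m ℕ.* n)) ⟩
    ι (ℤ.- ℤ.+ (suc m ℕ.* n))  ≈⟨ ι-neg (ℤ.+ (suc m ℕ.* n)) ⟩
    - μ (suc m ℕ.* n)        ≈⟨ -‿cong (×1-homo-* (suc m) n) ⟩
    - (μ (suc m) * μ n)      ≈⟨ -‿distribˡ-* _ _ ⟩
    - μ (suc m) * μ n        ∎
  ι-* -[1+ m ] -[1+ n ] = begin
    μ (suc m ℕ.* suc n)            ≈⟨ ×1-homo-* (suc m) (suc n) ⟩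
    μ (suc m) * μ (suc n)          ≈⟨ ⁻¹-involutive _ ⟨
    - - (μ (suc m) * μ (suc n))    ≈⟨ -‿cong (-‿distribˡ-* _ _) ⟩
    - (- μ (suc m) * μ (suc n))    ≈⟨ -‿distribʳ-* _ _ ⟩
    - μ (suc m) * - μ (suc n)      ∎

  ι-morphism : ℤ.+-*-rawRing -Raw-AlmostCommutative⟶ fromCommutativeRing R
  ι-morphism = record
    { ⟦_⟧    = ι
    ; +-homo = ι-+
    ; *-homo = ι-*
    ; -‿homo = ι-neg
    ; 0-homo = refl
    ; 1-homo = refl
    }

  -- Distinct integers give no answer, since `ι` need not be injective in a general ring. The solver
  -- only needs the positive case.
  ι-≟ : ∀ i j → Maybe (ι i ≈ ι j)
  ι-≟ i j with i ℤ.≟ j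
  ... | yes i≡j = just (reflexive (≡.cong ι i≡j))
  ... | no _    = nothing

  module Solver = RingSolver ℤ.+-*-rawRing (fromCommutativeRing R) ι-morphism ι-≟

module Designs {c ℓ₁ ℓ₂} (K : HeytingField c ℓ₁ ℓ₂) (charZero : CharZero K) where

  open HeytingField K using (#⇒invertible; #-irrefl; heytingCommutativeRing)
  open HeytingCommutativeRing heytingCommutativeRing using (commutativeRing)
  open CommutativeRing commutativeRing hiding (zero)
  open DiscreteHarmonic K charZero
  open IntegerMultiples commutativeRing using (ι; ι-+; ι-neg; ι-*; module Solver)
  open Solver using (solve; _:=_; _:+_; _:*_; _:-_; :-_; con)
  open Multᵤ semiring using (×-homo-+; ×1-homo-*) renaming (_×_ to _×ₙ_)
  open Mult semiring using (×ᵤ≈×)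
  open AbelianGroupProperties +-abelianGroup using (∙-cancelˡ; ∙-cancelʳ; x∙y⁻¹≈ε⇒x≈y)
  open RingProperties ring using (-0#≈0#)
  open import Relation.Binary.Reasoning.Setoid setoid

  -- The unoptimised multiple, as in `CharZero`: `ν (suc n)` unfolds to `1# + ν n`, which the
  -- inductions on sets rely on.
  ν : ℕ → Carrier
  ν n = n ×ₙ 1#

  ν-cancel : ∀ n {x} → ν (suc n) * x ≈ 0# → x ≈ 0#
  ν-cancel n {x} νx≈0 with #⇒invertible (charZero n)
  ... | y , yν≈1 , _ = begin
    x                            ≈⟨ *-identityˡ x ⟨
    1# * x                       ≈⟨ *-congʳ yν≈1 ⟨
    -- Apartness from `0#` yields an inverse of the difference with `0#`, hence the extra term.
    y * (ν (suc n) - 0#) * x     ≈⟨ solve 3 (λ y a x → y :* (a :- con (ℤ.+ 0)) :* x :=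
         y :* (a :* x)) refl y (ν (suc n)) x ⟩
    y * (ν (suc n) * x)          ≈⟨ *-congˡ νx≈0 ⟩
    y * 0#                       ≈⟨ zeroʳ y ⟩
    0#                           ∎

  ν≈0⇒≡0 : ∀ n → ν n ≈ 0# → n ≡ 0
  ν≈0⇒≡0 zero    _    = ≡.refl
  ν≈0⇒≡0 (suc n) ν≈0 = contradiction (charZero n) (#-irrefl ν≈0)

  -- The witness `o` replaces truncated subtraction. It shows that a difference in the field is a
  -- natural number, so that `ν-cancel` applies to it.
  ν-∸ : ∀ m o {n} → m ℕ.+ o ≡ n → ν o ≈ ν n - ν m
  ν-∸ m o ≡.refl = begin
    ν o                 ≈⟨ solve 2 (λ m o → o := m :+ o :- m) refl (ν m) (ν o) ⟩
    ν m + ν o - ν m     ≈⟨ +-congʳ (×-homo-+ 1# m o) ⟨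
    ν (m ℕ.+ o) - ν m   ∎

  ½*2≈1 : ½ * (1# + 1#) ≈ 1#
  ½*2≈1 = trans (*-congˡ (solve 0 (con (ℤ.+ 1) :+ con (ℤ.+ 1) :=
       con (ℤ.+ 1) :+ (con (ℤ.+ 1) :+ con (ℤ.+ 0)) :- con (ℤ.+ 0)) refl))
                (proj₁ (proj₂ (#⇒invertible (charZero 1))))

  -- Sums over lists

  private variable
    ℓ₃ ℓ₄ : Level
    A : Set ℓ₃
    B : Set ℓ₄
    n : ℕ

  ∑-cong : {f g : A → Carrier} (xs : List A) → (∀ x → f x ≈ g x) → ∑ xs f ≈ ∑ xs g
  ∑-cong []       f≈g = refl
  ∑-cong (x ∷ xs) f≈g = +-cong (f≈g x) (∑-cong xs f≈g)

  ∑-congAll : {f g : A → Carrier} {xs : List A} → All (λ x → f x ≈ g x) xs → ∑ xs f ≈ ∑ xs g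
  ∑-congAll []         = refl
  ∑-congAll (px ∷ pxs) = +-cong px (∑-congAll pxs)

  ∑-zero : (xs : List A) → ∑ xs (λ _ → 0#) ≈ 0#
  ∑-zero []       = refl
  ∑-zero (x ∷ xs) = trans (+-identityˡ _) (∑-zero xs)

  ∑-+ : (xs : List A) (f g : A → Carrier) → ∑ xs (λ x → f x + g x) ≈ ∑ xs f + ∑ xs g
  ∑-+ []       f g = sym (+-identityˡ 0#)
  ∑-+ (x ∷ xs) f g = trans (+-congˡ (∑-+ xs f g))
    (solve 4 (λ a b c d → (a :+ b) :+ (c :+ d) := (a :+ c) :+ (b :+ d)) refl _ _ _ _)

  ∑-*ˡ : (xs : List A) (k : Carrier) (f : A → Carrier) → ∑ xs (λ x → k * f x) ≈ k * ∑ xs f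
  ∑-*ˡ []       k f = sym (zeroʳ k)
  ∑-*ˡ (x ∷ xs) k f = trans (+-congˡ (∑-*ˡ xs k f)) (sym (distribˡ k _ _))

  ∑-*ʳ : (xs : List A) (f : A → Carrier) (k : Carrier) → ∑ xs (λ x → f x * k) ≈ ∑ xs f * k
  ∑-*ʳ []       f k = sym (zeroˡ k)
  ∑-*ʳ (x ∷ xs) f k = trans (+-congˡ (∑-*ʳ xs f k)) (sym (distribʳ k _ _))

  ∑-neg : (xs : List A) (f : A → Carrier) → ∑ xs (λ x → - f x) ≈ - ∑ xs f
  ∑-neg []       f = sym -0#≈0#
  ∑-neg (x ∷ xs) f = trans (+-congˡ (∑-neg xs f))
    (solve 2 (λ a b → :- a :+ :- b := :- (a :+ b)) refl _ _)

  ∑-map : (h : A → B) (xs : List A) (f : B → Carrier) → ∑ (map h xs) f ≡ ∑ xs (f ∘ h)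
  ∑-map h []       f = ≡.refl
  ∑-map h (x ∷ xs) f = ≡.cong (_ +_) (∑-map h xs f)

  ∑-++ : (xs ys : List A) (f : A → Carrier) → ∑ (xs ++ ys) f ≈ ∑ xs f + ∑ ys f
  ∑-++ []       ys f = sym (+-identityˡ _)
  ∑-++ (x ∷ xs) ys f = trans (+-congˡ (∑-++ xs ys f)) (sym (+-assoc _ _ _))

  ∑-swap : (xs : List A) (ys : List B) (f : A → B → Carrier) →
    ∑ xs (λ x → ∑ ys (f x)) ≈ ∑ ys (λ y → ∑ xs (λ x → f x y))
  ∑-swap []       ys f = sym (∑-zero ys)
  ∑-swap (x ∷ xs) ys f = trans (+-congˡ (∑-swap xs ys f)) (sym (∑-+ ys _ _))

  ∑-swap-*ˡ : (xs : List A) (ys : List B) (k : B → Carrier) (f : B → A → Carrier) →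
    ∑ xs (λ x → ∑ ys (λ y → k y * f y x)) ≈ ∑ ys (λ y → k y * ∑ xs (f y))
  ∑-swap-*ˡ xs ys k f = trans (∑-swap xs ys _) (∑-cong ys (λ y → ∑-*ˡ xs (k y) (f y)))

  -- The Iverson bracket. It turns sums over filtered lists into weighted sums over full lists,
  -- where linearity and exchange of summation apply.
  [_] : ∀ {p} {P : Set p} → Dec P → Carrier
  [ P? ] = if does P? then 1# else 0#

  []-cong : ∀ {p} {P : Set p} (P? : Dec P) {x y} → (P → x ≈ y) → [ P? ] * x ≈ [ P? ] * y
  []-cong (yes p) x≈y = *-congˡ (x≈y p)
  []-cong (no _)  x≈y = trans (zeroˡ _) (sym (zeroˡ _))

  ∑-filter : ∀ {p} {P : A → Set p} (P? : ∀ x → Dec (P x)) (xs : List A) (f : A → Carrier) →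
    ∑ (filter P? xs) f ≈ ∑ xs (λ x → [ P? x ] * f x)
  ∑-filter P? []       f = refl
  ∑-filter P? (x ∷ xs) f with does (P? x)
  ... | true  = +-cong (sym (*-identityˡ _)) (∑-filter P? xs f)
  ... | false = trans (∑-filter P? xs f) (sym (trans (+-congʳ (zeroˡ _)) (+-identityˡ _)))

  ν-length-filter : ∀ {p} {P : A → Set p} (P? : ∀ x → Dec (P x)) (xs : List A) →
    ν (length (filter P? xs)) ≈ ∑ xs (λ x → [ P? x ])
  ν-length-filter P? []       = refl
  ν-length-filter P? (x ∷ xs) with does (P? x)
  ... | true  = +-congˡ (ν-length-filter P? xs)
  ... | false = trans (ν-length-filter P? xs) (sym (+-identityˡ _))

  ∑-cube : (f : Subset (suc n) → Carrier) →
    ∑ (cube (suc n)) f ≈ ∑ (cube n) (f ∘ (outside ∷_)) + ∑ (cube n) (f ∘ (inside ∷_))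
  ∑-cube {n} f = trans (∑-++ (map (outside ∷_) (cube n)) _ f)
    (reflexive (≡.cong₂ _+_ (∑-map (outside ∷_) (cube n) f) (∑-map (inside ∷_) (cube n) f)))

  -- Neighbours of a set in the cube, by deleting or adding one element.

  down up : Subset n → List (Subset n)
  down []            = []
  down (outside ∷ S) = map (outside ∷_) (down S)
  down (inside  ∷ S) = (outside ∷ S) ∷ map (inside ∷_) (down S)
  up []            = []
  up (outside ∷ S) = (inside ∷ S) ∷ map (outside ∷_) (up S)
  up (inside  ∷ S) = map (inside ∷_) (up S)

  ∑-down-outside : (S : Subset n) (f : Fun (suc n)) →
    ∑ (down (outside ∷ S)) f ≈ ∑ (down S) (f ∘ (outside ∷_))
  ∑-down-outside S f = reflexive (∑-map (outside ∷_) (down S) f)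

  ∑-down-inside : (S : Subset n) (f : Fun (suc n)) →
    ∑ (down (inside ∷ S)) f ≈ f (outside ∷ S) + ∑ (down S) (f ∘ (inside ∷_))
  ∑-down-inside S f = +-congˡ (reflexive (∑-map (inside ∷_) (down S) f))

  ∑-up-outside : (S : Subset n) (f : Fun (suc n)) →
    ∑ (up (outside ∷ S)) f ≈ f (inside ∷ S) + ∑ (up S) (f ∘ (outside ∷_))
  ∑-up-outside S f = +-congˡ (reflexive (∑-map (outside ∷_) (up S) f))

  ∑-up-inside : (S : Subset n) (f : Fun (suc n)) →
    ∑ (up (inside ∷ S)) f ≈ ∑ (up S) (f ∘ (inside ∷_))
  ∑-up-inside S f = reflexive (∑-map (inside ∷_) (up S) f)

  ∑-down-1 : (S : Subset n) → ∑ (down S) (λ _ → 1#) ≈ ν ∣ S ∣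
  ∑-down-1 []            = refl
  ∑-down-1 (outside ∷ S) = trans (∑-down-outside S _) (∑-down-1 S)
  ∑-down-1 (inside  ∷ S) = trans (∑-down-inside S _) (+-congˡ (∑-down-1 S))

  ∑-up-1 : (S : Subset n) → ∑ (up S) (λ _ → 1#) ≈ ν n - ν ∣ S ∣
  ∑-up-1 []            = sym (-‿inverseʳ 0#)
  ∑-up-1 {suc n} (outside ∷ S) = begin
    ∑ (up (outside ∷ S)) (λ _ → 1#)   ≈⟨ ∑-up-outside S _ ⟩
    1# + ∑ (up S) (λ _ → 1#)          ≈⟨ +-congˡ (∑-up-1 S) ⟩
    1# + (ν n - ν ∣ S ∣)              ≈⟨ +-assoc _ _ _ ⟨
    1# + ν n - ν ∣ S ∣                ∎
  ∑-up-1 {suc n} (inside ∷ S) = begin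
    ∑ (up (inside ∷ S)) (λ _ → 1#)      ≈⟨ ∑-up-inside S _ ⟩
    ∑ (up S) (λ _ → 1#)                 ≈⟨ ∑-up-1 S ⟩
    ν n - ν ∣ S ∣                       ≈⟨ solve 2 (λ n k → n :- k :=
         con (ℤ.+ 1) :+ n :- (con (ℤ.+ 1) :+ k)) refl (ν n) (ν ∣ S ∣) ⟩
    (1# + ν n) - (1# + ν ∣ S ∣)         ∎

  ∑-down-const : ∀ {f : Fun n} {k} (S : Subset n) →
    (∀ T → suc ∣ T ∣ ≡ ∣ S ∣ → f T ≈ k) → ∑ (down S) f ≈ ν ∣ S ∣ * k
  ∑-down-const [] f≈k = sym (zeroˡ _)
  ∑-down-const {f = f} (outside ∷ S) f≈k =
    trans (∑-down-outside S f) (∑-down-const S (λ T → f≈k (outside ∷ T)))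
  ∑-down-const {f = f} {k} (inside ∷ S) f≈k = begin
    ∑ (down (inside ∷ S)) f                             ≈⟨ ∑-down-inside S f ⟩
    f (outside ∷ S) + ∑ (down S) (f ∘ (inside ∷_))
      ≈⟨ +-cong (f≈k (outside ∷ S) ≡.refl)
           (∑-down-const S (λ T eq → f≈k (inside ∷ T) (≡.cong suc eq))) ⟩
    k + ν ∣ S ∣ * k                                     ≈⟨ solve 2 (λ k s → k :+ s :* k :=
         (con (ℤ.+ 1) :+ s) :* k) refl k (ν ∣ S ∣) ⟩
    (1# + ν ∣ S ∣) * k                                  ∎

  -- Deleting and adding an element are adjoint: both sides sum over pairs I ⊂ J
  -- with ∣ J ∣ = 1 + ∣ I ∣.
  ∑-down-up : (p : ℕ → Carrier) (f g : Fun n) →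
    ∑ (cube n) (λ J → p ∣ J ∣ * f J * ∑ (down J) g) ≈
    ∑ (cube n) (λ I → p (suc ∣ I ∣) * ∑ (up I) f * g I)
  ∑-down-up {zero} p f g =
    solve 4 (λ p₀ p₁ x y → p₀ :* x :* con (ℤ.+ 0) :+ con (ℤ.+ 0) := p₁ :* con (ℤ.+ 0) :* y :+ con (ℤ.+ 0))
      refl (p 0) (p 1) (f []) (g [])
  ∑-down-up {suc n} p f g = begin
    ∑ (cube (suc n)) (λ J → p ∣ J ∣ * f J * ∑ (down J) g)
      ≈⟨ ∑-cube {n} _ ⟩
    ∑ (cube n) (λ J → p ∣ J ∣ * fₒ J * ∑ (down (outside ∷ J)) g) +
    ∑ (cube n) (λ J → p (suc ∣ J ∣) * fᵢ J * ∑ (down (inside ∷ J)) g)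
      ≈⟨ +-cong (∑-cong (cube n) (λ J → *-congˡ (∑-down-outside J g)))
                (∑-cong (cube n) (λ J → trans (*-congˡ (∑-down-inside J g)) (distribˡ _ _ _))) ⟩
    ∑ (cube n) (λ J → p ∣ J ∣ * fₒ J * ∑ (down J) gₒ) +
    ∑ (cube n) (λ J → p (suc ∣ J ∣) * fᵢ J * gₒ J + p (suc ∣ J ∣) * fᵢ J * ∑ (down J) gᵢ)
      -- Sets in the inside half are larger by one, so the induction needs the shifted weight
      -- `p ∘ suc`. This is why `p` is arbitrary.
      ≈⟨ +-cong (∑-down-up p fₒ gₒ)
                (trans (∑-+ (cube n) _ _) (+-congˡ (∑-down-up (p ∘ suc) fᵢ gᵢ))) ⟩
    ∑ (cube n) (λ I → p (suc ∣ I ∣) * ∑ (up I) fₒ * gₒ I) +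
    (∑ (cube n) (λ I → p (suc ∣ I ∣) * fᵢ I * gₒ I) +
     ∑ (cube n) (λ I → p (suc (suc ∣ I ∣)) * ∑ (up I) fᵢ * gᵢ I))
      ≈⟨ +-assoc _ _ _ ⟨
    ∑ (cube n) (λ I → p (suc ∣ I ∣) * ∑ (up I) fₒ * gₒ I) +
    ∑ (cube n) (λ I → p (suc ∣ I ∣) * fᵢ I * gₒ I) +
    ∑ (cube n) (λ I → p (suc (suc ∣ I ∣)) * ∑ (up I) fᵢ * gᵢ I)
      -- The middle sum runs over the pairs that differ in the first element. It came from the
      -- inside half of the J and joins the outside half of the I.
      ≈⟨ +-cong
           (trans (sym (∑-+ (cube n) _ _)) (∑-cong (cube n) (λ I → trans
             (solve 4 (λ p u x g → p :* u :* g :+ p :* x :* g := p :* (x :+ u) :* g) refl _ _ _ _)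
             (*-congʳ (*-congˡ (sym (∑-up-outside I f)))))))
           (∑-cong (cube n) (λ I → *-congʳ (*-congˡ (sym (∑-up-inside I f))))) ⟩
    ∑ (cube n) (λ I → p (suc ∣ I ∣) * ∑ (up (outside ∷ I)) f * gₒ I) +
    ∑ (cube n) (λ I → p (suc (suc ∣ I ∣)) * ∑ (up (inside ∷ I)) f * gᵢ I)
      ≈⟨ ∑-cube {n} _ ⟨
    ∑ (cube (suc n)) (λ I → p (suc ∣ I ∣) * ∑ (up I) f * g I) ∎
    where
    fₒ fᵢ gₒ gᵢ : Fun n
    fₒ = f ∘ (outside ∷_)
    fᵢ = f ∘ (inside ∷_)
    gₒ = g ∘ (outside ∷_)
    gᵢ = g ∘ (inside ∷_)

  -- Characters

  ∏-filter : ∀ {p} {P : A → Set p} (P? : ∀ x → Dec (P x)) (xs : List A) (f : A → Carrier) →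
    ∏ (filter P? xs) f ≈ ∏ xs (λ x → if does (P? x) then f x else 1#)
  ∏-filter P? []       f = refl
  ∏-filter P? (x ∷ xs) f with does (P? x)
  ... | true  = *-congˡ (∏-filter P? xs f)
  ... | false = trans (∏-filter P? xs f) (sym (*-identityˡ _))

  ∏-map : (h : A → B) (xs : List A) (f : B → Carrier) → ∏ (map h xs) f ≡ ∏ xs (f ∘ h)
  ∏-map h []       f = ≡.refl
  ∏-map h (x ∷ xs) f = ≡.cong (_ *_) (∏-map h xs f)

  allFin-suc : ∀ n → allFin (suc n) ≡ zero ∷ map suc (allFin n)
  allFin-suc n = ≡.cong (zero ∷_) (≡.sym (map-tabulate id suc))

  χ-∷ : ∀ b₁ b₂ (J v : Subset n) →
    χ (b₁ ∷ J) (b₂ ∷ v) ≈ (if b₁ then -1^ b₂ else 1#) * χ J v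
  χ-∷ {n} b₁ b₂ J v = begin
    χ (b₁ ∷ J) (b₂ ∷ v)                 ≈⟨ ∏-filter (_∈? (b₁ ∷ J)) (allFin (suc n)) _ ⟩
    ∏ (allFin (suc n)) factor           ≡⟨ ≡.cong (λ xs → ∏ xs factor) (allFin-suc n) ⟩
    factor zero * ∏ (map suc (allFin n)) factor
      ≡⟨ ≡.cong₂ _*_ (head b₁) (∏-map suc (allFin n) factor) ⟩
    (if b₁ then -1^ b₂ else 1#) * ∏ (allFin n) (factor ∘ suc)
      ≈⟨ *-congˡ (∏-filter (_∈? J) (allFin n) _) ⟨
    (if b₁ then -1^ b₂ else 1#) * χ J v ∎
    where
    factor : Fin (suc n) → Carrier
    factor j = if does (j ∈? (b₁ ∷ J)) then -1^ (lookup (b₂ ∷ v) j) else 1#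
    -- The membership test at `zero` reduces only once `b₁` is a constructor.
    head : ∀ b₁ → (if does (zero ∈? (b₁ ∷ J)) then -1^ b₂ else 1#) ≡ (if b₁ then -1^ b₂ else 1#)
    head true  = ≡.refl
    head false = ≡.refl

  χ-outsideˡ : ∀ b (J v : Subset n) → χ (outside ∷ J) (b ∷ v) ≈ χ J v
  χ-outsideˡ b J v = trans (χ-∷ outside b J v) (*-identityˡ _)

  χ-outsideʳ : ∀ b (J v : Subset n) → χ (b ∷ J) (outside ∷ v) ≈ χ J v
  χ-outsideʳ outside J v = χ-outsideˡ outside J v
  χ-outsideʳ inside  J v = trans (χ-∷ inside outside J v) (*-identityˡ _)

  χ-inside : (J v : Subset n) → χ (inside ∷ J) (inside ∷ v) ≈ - χ J v
  χ-inside J v = trans (χ-∷ inside inside J v)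
    (solve 1 (λ x → :- con (ℤ.+ 1) :* x := :- x) refl (χ J v))

  -- Both sides are -1 to the power ∣J ∩ v∣.
  χ-comm : (J v : Subset n) → χ J v ≈ χ v J
  χ-comm []            []            = refl
  χ-comm (outside ∷ J) (b ∷ v)       = trans (χ-outsideˡ b J v) (trans (χ-comm J v) (sym (χ-outsideʳ b v J)))
  χ-comm (inside  ∷ J) (outside ∷ v) = trans (χ-outsideʳ inside J v) (trans (χ-comm J v) (sym (χ-outsideˡ inside v J)))
  χ-comm (inside  ∷ J) (inside  ∷ v) = trans (χ-inside J v) (trans (-‿cong (χ-comm J v)) (sym (χ-inside v J)))

  ∑-χ-outsideˡ : ∀ b (J : Subset n) (vs : List (Subset n)) →
    ∑ vs (χ (outside ∷ J) ∘ (b ∷_)) ≈ ∑ vs (χ J)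
  ∑-χ-outsideˡ b J vs = ∑-cong vs (χ-outsideˡ b J)

  ∑-χ-outsideʳ : ∀ b (J : Subset n) (vs : List (Subset n)) →
    ∑ vs (χ (b ∷ J) ∘ (outside ∷_)) ≈ ∑ vs (χ J)
  ∑-χ-outsideʳ b J vs = ∑-cong vs (χ-outsideʳ b J)

  ∑-χ-inside : (J : Subset n) (vs : List (Subset n)) →
    ∑ vs (χ (inside ∷ J) ∘ (inside ∷_)) ≈ - ∑ vs (χ J)
  ∑-χ-inside J vs = trans (∑-cong vs (χ-inside J)) (∑-neg vs (χ J))

  -- Flipping coordinate j of v changes the sign of χ_J exactly when j ∈ J. So n - ∣J∣ neighbours
  -- contribute χ_J(v) and ∣J∣ contribute -χ_J(v).
  χ-down+up : (J v : Subset n) →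
    ∑ (down v) (χ J) + ∑ (up v) (χ J) ≈ (ν n - (ν ∣ J ∣ + ν ∣ J ∣)) * χ J v
  χ-down+up [] [] = solve 1 (λ x → con (ℤ.+ 0) :+ con (ℤ.+ 0) :=
       (con (ℤ.+ 0) :- (con (ℤ.+ 0) :+ con (ℤ.+ 0))) :* x) refl (χ [] [])
  χ-down+up {suc n} (outside ∷ J) (outside ∷ v) = begin
    ∑ (down (outside ∷ v)) (χ (outside ∷ J)) + ∑ (up (outside ∷ v)) (χ (outside ∷ J))
      ≈⟨ +-cong (trans (∑-down-outside v _) (∑-χ-outsideˡ outside J (down v)))
                (trans (∑-up-outside v _) (+-cong (χ-outsideˡ inside J v) (∑-χ-outsideˡ outside J (up v)))) ⟩
    ∑ (down v) (χ J) + (χ J v + ∑ (up v) (χ J))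
      ≈⟨ solve 3 (λ l x u → l :+ (x :+ u) := l :+ u :+ x) refl _ _ _ ⟩
    ∑ (down v) (χ J) + ∑ (up v) (χ J) + χ J v
      ≈⟨ +-congʳ (χ-down+up J v) ⟩
    (ν n - (ν ∣ J ∣ + ν ∣ J ∣)) * χ J v + χ J v
      ≈⟨ solve 3 (λ n k x → (n :- (k :+ k)) :* x :+ x :=
           (con (ℤ.+ 1) :+ n :- (k :+ k)) :* x) refl (ν n) (ν ∣ J ∣) _ ⟩
    (ν (suc n) - (ν ∣ J ∣ + ν ∣ J ∣)) * χ J v
      ≈⟨ *-congˡ (χ-outsideˡ outside J v) ⟨
    (ν (suc n) - (ν ∣ J ∣ + ν ∣ J ∣)) * χ (outside ∷ J) (outside ∷ v) ∎
  χ-down+up {suc n} (outside ∷ J) (inside ∷ v) = begin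
    ∑ (down (inside ∷ v)) (χ (outside ∷ J)) + ∑ (up (inside ∷ v)) (χ (outside ∷ J))
      ≈⟨ +-cong (trans (∑-down-inside v _) (+-cong (χ-outsideˡ outside J v) (∑-χ-outsideˡ inside J (down v))))
                (trans (∑-up-inside v _) (∑-χ-outsideˡ inside J (up v))) ⟩
    χ J v + ∑ (down v) (χ J) + ∑ (up v) (χ J)
      ≈⟨ solve 3 (λ x l u → x :+ l :+ u := l :+ u :+ x) refl _ _ _ ⟩
    ∑ (down v) (χ J) + ∑ (up v) (χ J) + χ J v
      ≈⟨ +-congʳ (χ-down+up J v) ⟩
    (ν n - (ν ∣ J ∣ + ν ∣ J ∣)) * χ J v + χ J v
      ≈⟨ solve 3 (λ n k x → (n :- (k :+ k)) :* x :+ x :=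
           (con (ℤ.+ 1) :+ n :- (k :+ k)) :* x) refl (ν n) (ν ∣ J ∣) _ ⟩
    (ν (suc n) - (ν ∣ J ∣ + ν ∣ J ∣)) * χ J v
      ≈⟨ *-congˡ (χ-outsideˡ inside J v) ⟨
    (ν (suc n) - (ν ∣ J ∣ + ν ∣ J ∣)) * χ (outside ∷ J) (inside ∷ v) ∎
  χ-down+up {suc n} (inside ∷ J) (outside ∷ v) = begin
    ∑ (down (outside ∷ v)) (χ (inside ∷ J)) + ∑ (up (outside ∷ v)) (χ (inside ∷ J))
      ≈⟨ +-cong (trans (∑-down-outside v _) (∑-χ-outsideʳ inside J (down v)))
                (trans (∑-up-outside v _) (+-cong (χ-inside J v) (∑-χ-outsideʳ inside J (up v)))) ⟩
    ∑ (down v) (χ J) + (- χ J v + ∑ (up v) (χ J))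
      ≈⟨ solve 3 (λ l x u → l :+ (:- x :+ u) := l :+ u :- x) refl _ _ _ ⟩
    ∑ (down v) (χ J) + ∑ (up v) (χ J) - χ J v
      ≈⟨ +-congʳ (χ-down+up J v) ⟩
    (ν n - (ν ∣ J ∣ + ν ∣ J ∣)) * χ J v - χ J v
      ≈⟨ solve 3 (λ n k x → (n :- (k :+ k)) :* x :- x :=
           (con (ℤ.+ 1) :+ n :- (con (ℤ.+ 1) :+ k :+ (con (ℤ.+ 1) :+ k))) :* x) refl (ν n) (ν ∣ J ∣) _ ⟩
    (ν (suc n) - (ν (suc ∣ J ∣) + ν (suc ∣ J ∣))) * χ J v
      ≈⟨ *-congˡ (χ-outsideʳ inside J v) ⟨
    (ν (suc n) - (ν (suc ∣ J ∣) + ν (suc ∣ J ∣))) * χ (inside ∷ J) (outside ∷ v) ∎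
  χ-down+up {suc n} (inside ∷ J) (inside ∷ v) = begin
    ∑ (down (inside ∷ v)) (χ (inside ∷ J)) + ∑ (up (inside ∷ v)) (χ (inside ∷ J))
      ≈⟨ +-cong (trans (∑-down-inside v _) (+-cong (χ-outsideʳ inside J v) (∑-χ-inside J (down v))))
                (trans (∑-up-inside v _) (∑-χ-inside J (up v))) ⟩
    χ J v - ∑ (down v) (χ J) - ∑ (up v) (χ J)
      ≈⟨ solve 3 (λ x l u → x :- l :- u := x :- (l :+ u)) refl _ _ _ ⟩
    χ J v - (∑ (down v) (χ J) + ∑ (up v) (χ J))
      ≈⟨ +-congˡ (-‿cong (χ-down+up J v)) ⟩
    χ J v - (ν n - (ν ∣ J ∣ + ν ∣ J ∣)) * χ J v
      ≈⟨ solve 3 (λ n k x → x :- (n :- (k :+ k)) :* x :=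
           (con (ℤ.+ 1) :+ n :- (con (ℤ.+ 1) :+ k :+ (con (ℤ.+ 1) :+ k))) :* :- x) refl (ν n) (ν ∣ J ∣) _ ⟩
    (ν (suc n) - (ν (suc ∣ J ∣) + ν (suc ∣ J ∣))) * - χ J v
      ≈⟨ *-congˡ (χ-inside J v) ⟨
    (ν (suc n) - (ν (suc ∣ J ∣) + ν (suc ∣ J ∣))) * χ (inside ∷ J) (inside ∷ v) ∎

  -- The sum over `down v` is (∣v∣ - 2∣J ∩ v∣) χ_J(v), so both sides equal χ_J(v) times the size of
  -- the symmetric difference of J and v.
  χ-down-comm : (J v : Subset n) →
    ∑ (down v) (χ J) + ν ∣ J ∣ * χ J v ≈ ∑ (down J) (χ v) + ν ∣ v ∣ * χ J v
  χ-down-comm [] [] = refl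
  χ-down-comm (outside ∷ J) (outside ∷ v) = begin
    ∑ (down (outside ∷ v)) (χ (outside ∷ J)) + ν ∣ J ∣ * χ (outside ∷ J) (outside ∷ v)
      ≈⟨ +-cong (trans (∑-down-outside v _) (∑-χ-outsideˡ outside J (down v)))
           (*-congˡ (χ-outsideˡ outside J v)) ⟩
    ∑ (down v) (χ J) + ν ∣ J ∣ * χ J v
      ≈⟨ χ-down-comm J v ⟩
    ∑ (down J) (χ v) + ν ∣ v ∣ * χ J v
      ≈⟨ +-cong (trans (∑-down-outside J _) (∑-χ-outsideˡ outside v (down J)))
           (*-congˡ (χ-outsideˡ outside J v)) ⟨
    ∑ (down (outside ∷ J)) (χ (outside ∷ v)) + ν ∣ v ∣ * χ (outside ∷ J) (outside ∷ v) ∎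
  χ-down-comm (outside ∷ J) (inside ∷ v) = begin
    ∑ (down (inside ∷ v)) (χ (outside ∷ J)) + ν ∣ J ∣ * χ (outside ∷ J) (inside ∷ v)
      ≈⟨ +-cong (trans (∑-down-inside v _)
           (+-cong (χ-outsideˡ outside J v) (∑-χ-outsideˡ inside J (down v))))
                (*-congˡ (χ-outsideˡ inside J v)) ⟩
    χ J v + ∑ (down v) (χ J) + ν ∣ J ∣ * χ J v
      ≈⟨ +-assoc _ _ _ ⟩
    χ J v + (∑ (down v) (χ J) + ν ∣ J ∣ * χ J v)
      ≈⟨ +-congˡ (χ-down-comm J v) ⟩
    χ J v + (∑ (down J) (χ v) + ν ∣ v ∣ * χ J v)
      ≈⟨ solve 3 (λ x l k → x :+ (l :+ k :* x) := l :+ (con (ℤ.+ 1) :+ k) :* x) refl _ _ _ ⟩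
    ∑ (down J) (χ v) + ν (suc ∣ v ∣) * χ J v
      ≈⟨ +-cong (trans (∑-down-outside J _) (∑-χ-outsideʳ inside v (down J)))
           (*-congˡ (χ-outsideˡ inside J v)) ⟨
    ∑ (down (outside ∷ J)) (χ (inside ∷ v)) + ν (suc ∣ v ∣) * χ (outside ∷ J) (inside ∷ v) ∎
  χ-down-comm (inside ∷ J) (outside ∷ v) = begin
    ∑ (down (outside ∷ v)) (χ (inside ∷ J)) + ν (suc ∣ J ∣) * χ (inside ∷ J) (outside ∷ v)
      ≈⟨ +-cong (trans (∑-down-outside v _) (∑-χ-outsideʳ inside J (down v)))
           (*-congˡ (χ-outsideʳ inside J v)) ⟩
    ∑ (down v) (χ J) + ν (suc ∣ J ∣) * χ J v
      ≈⟨ solve 3 (λ x l k → l :+ (con (ℤ.+ 1) :+ k) :* x := x :+ (l :+ k :* x)) refl _ _ _ ⟩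
    χ J v + (∑ (down v) (χ J) + ν ∣ J ∣ * χ J v)
      ≈⟨ +-congˡ (χ-down-comm J v) ⟩
    χ J v + (∑ (down J) (χ v) + ν ∣ v ∣ * χ J v)
      ≈⟨ +-assoc _ _ _ ⟨
    χ J v + ∑ (down J) (χ v) + ν ∣ v ∣ * χ J v
      ≈⟨ +-cong (trans (∑-down-inside J _)
           (+-cong (trans (χ-outsideˡ outside v J) (χ-comm v J)) (∑-χ-outsideˡ inside v (down J))))
                (*-congˡ (χ-outsideʳ inside J v)) ⟨
    ∑ (down (inside ∷ J)) (χ (outside ∷ v)) + ν ∣ v ∣ * χ (inside ∷ J) (outside ∷ v) ∎
  χ-down-comm (inside ∷ J) (inside ∷ v) = begin
    ∑ (down (inside ∷ v)) (χ (inside ∷ J)) + ν (suc ∣ J ∣) * χ (inside ∷ J) (inside ∷ v)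
      ≈⟨ +-cong (trans (∑-down-inside v _)
           (+-cong (χ-outsideʳ inside J v) (∑-χ-inside J (down v)))) (*-congˡ (χ-inside J v)) ⟩
    χ J v - ∑ (down v) (χ J) + ν (suc ∣ J ∣) * - χ J v
      ≈⟨ solve 3 (λ x l k → x :- l :+ (con (ℤ.+ 1) :+ k) :* :- x := :- (l :+ k :* x)) refl _ _ _ ⟩
    - (∑ (down v) (χ J) + ν ∣ J ∣ * χ J v)
      ≈⟨ -‿cong (χ-down-comm J v) ⟩
    - (∑ (down J) (χ v) + ν ∣ v ∣ * χ J v)
      ≈⟨ solve 3 (λ x l k → x :- l :+ (con (ℤ.+ 1) :+ k) :* :- x := :- (l :+ k :* x)) refl _ _ _ ⟨
    χ J v - ∑ (down J) (χ v) + ν (suc ∣ v ∣) * - χ J v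
      ≈⟨ +-cong (trans (∑-down-inside J _)
           (+-cong (trans (χ-outsideʳ inside v J) (χ-comm v J)) (∑-χ-inside v (down J))))
                (*-congˡ (χ-inside J v)) ⟨
    ∑ (down (inside ∷ J)) (χ (inside ∷ v)) + ν (suc ∣ v ∣) * χ (inside ∷ J) (inside ∷ v) ∎

  -- The operator X̃′

  ⨂-∷ : ∀ M (Ms : Vec Mat₂ n) (f : Fun (suc n)) b v →
    ⨂ (M ∷ Ms) f (b ∷ v) ≈
    M b false * ⨂ Ms (f ∘ (outside ∷_)) v + M b true * ⨂ Ms (f ∘ (inside ∷_)) v
  ⨂-∷ {n} M Ms f b v = trans (∑-cube {n} _) (+-cong (row outside) (row inside))
    where
    row : ∀ b′ → ∑ (cube n) (λ u → entry (M ∷ Ms) (b ∷ v) (b′ ∷ u) * f (b′ ∷ u)) ≈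
                 M b b′ * ⨂ Ms (f ∘ (b′ ∷_)) v
    row b′ = trans (∑-cong (cube n) (λ u → *-assoc _ _ _)) (∑-*ˡ (cube n) _ _)

  ⨂-I₂∷ : (Ms : Vec Mat₂ n) (f : Fun (suc n)) → ∀ b v →
    ⨂ (I₂ ∷ Ms) f (b ∷ v) ≈ ⨂ Ms (f ∘ (b ∷_)) v
  ⨂-I₂∷ Ms f false v = trans (⨂-∷ I₂ Ms f false v)
    (solve 2 (λ x y → con (ℤ.+ 1) :* x :+ con (ℤ.+ 0) :* y := x) refl _ _)
  ⨂-I₂∷ Ms f true v = trans (⨂-∷ I₂ Ms f true v)
    (solve 2 (λ x y → con (ℤ.+ 0) :* x :+ con (ℤ.+ 1) :* y := y) refl _ _)

  ⨂-I₂ : (f : Fun n) → ∀ v → ⨂ (replicate n I₂) f v ≈ f v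
  ⨂-I₂ f []      = solve 1 (λ x → con (ℤ.+ 1) :* x :+ con (ℤ.+ 0) := x) refl _
  ⨂-I₂ f (b ∷ v) = trans (⨂-I₂∷ _ f b v) (⨂-I₂ (f ∘ (b ∷_)) v)

  -- The two rows of `X′` agree, so the term for the first coordinate does not depend on `b`. The
  -- other terms act as the identity there.
  X̃′-∷ : (f : Fun (suc n)) → ∀ b v →
    X̃′ f (b ∷ v) ≈ ½ * (f (outside ∷ v) - f (inside ∷ v)) + X̃′ (f ∘ (b ∷_)) v
  X̃′-∷ {n} f b v = begin
    ∑ (allFin (suc n)) (λ j → ⨂ (replicate (suc n) I₂ [ j ]≔ X′) f (b ∷ v))
      ≡⟨ ≡.cong (λ js → ∑ js (λ j → ⨂ (replicate (suc n) I₂ [ j ]≔ X′) f (b ∷ v))) (allFin-suc n) ⟩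
    ⨂ (X′ ∷ replicate n I₂) f (b ∷ v) +
    ∑ (map suc (allFin n)) (λ j → ⨂ (replicate (suc n) I₂ [ j ]≔ X′) f (b ∷ v))
      ≈⟨ +-cong (⨂-∷ X′ (replicate n I₂) f b v) (reflexive (∑-map suc (allFin n) _)) ⟩
    ½ * 1# * ⨂ (replicate n I₂) (f ∘ (outside ∷_)) v +
    ½ * - 1# * ⨂ (replicate n I₂) (f ∘ (inside ∷_)) v +
    ∑ (allFin n) (λ j → ⨂ (I₂ ∷ (replicate n I₂ [ j ]≔ X′)) f (b ∷ v))
      ≈⟨ +-cong (+-cong (*-congˡ (⨂-I₂ (f ∘ (outside ∷_)) v)) (*-congˡ (⨂-I₂ (f ∘ (inside ∷_)) v)))
                (∑-cong (allFin n) (λ j → ⨂-I₂∷ (replicate n I₂ [ j ]≔ X′) f b v)) ⟩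
    ½ * 1# * f (outside ∷ v) + ½ * - 1# * f (inside ∷ v) + X̃′ (f ∘ (b ∷_)) v
      ≈⟨ +-congʳ (solve 3 (λ h x y → h :* con (ℤ.+ 1) :* x :+ h :* (:- con (ℤ.+ 1)) :* y :=
           h :* (x :- y)) refl _ _ _) ⟩
    ½ * (f (outside ∷ v) - f (inside ∷ v)) + X̃′ (f ∘ (b ∷_)) v ∎

  -- Coordinate j contributes ½ (f(v - j) - f(v)) if j ∈ v and ½ (f(v) - f(v + j)) otherwise. The
  -- multiples of f(v) add up to n - 2∣v∣ halves.
  X̃′-down-up : (f : Fun n) → ∀ v →
    X̃′ f v ≈ ½ * (∑ (down v) f - ∑ (up v) f + (ν n - (ν ∣ v ∣ + ν ∣ v ∣)) * f v)
  X̃′-down-up f [] = solve 2 (λ h x → con (ℤ.+ 0) :=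
    h :* (con (ℤ.+ 0) :- con (ℤ.+ 0) :+ (con (ℤ.+ 0) :- (con (ℤ.+ 0) :+ con (ℤ.+ 0))) :* x)) refl ½ (f [])
  X̃′-down-up {suc n} f (outside ∷ v) = begin
    X̃′ f (outside ∷ v)
      ≈⟨ trans (X̃′-∷ f outside v) (+-congˡ (X̃′-down-up (f ∘ (outside ∷_)) v)) ⟩
    ½ * (f (outside ∷ v) - f (inside ∷ v)) +
    ½ * (∑ (down v) (f ∘ (outside ∷_)) - ∑ (up v) (f ∘ (outside ∷_)) + (ν n - (ν ∣ v ∣ + ν ∣ v ∣)) * f (outside ∷ v))
      ≈⟨ solve 7 (λ h x y l u n k → h :* (x :- y) :+ h :* (l :- u :+ (n :- (k :+ k)) :* x) :=
           h :* (l :- (y :+ u) :+ (con (ℤ.+ 1) :+ n :- (k :+ k)) :* x)) refl _ _ _ _ _ (ν n) (ν ∣ v ∣) ⟩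
    ½ * (∑ (down v) (f ∘ (outside ∷_)) - (f (inside ∷ v) + ∑ (up v) (f ∘ (outside ∷_))) + (ν (suc n) - (ν ∣ v ∣ + ν ∣ v ∣)) * f (outside ∷ v))
      ≈⟨ *-congˡ (+-congʳ (+-cong (∑-down-outside v f) (-‿cong (∑-up-outside v f)))) ⟨
    ½ * (∑ (down (outside ∷ v)) f - ∑ (up (outside ∷ v)) f + (ν (suc n) - (ν ∣ v ∣ + ν ∣ v ∣)) * f (outside ∷ v)) ∎
  X̃′-down-up {suc n} f (inside ∷ v) = begin
    X̃′ f (inside ∷ v)
      ≈⟨ trans (X̃′-∷ f inside v) (+-congˡ (X̃′-down-up (f ∘ (inside ∷_)) v)) ⟩
    ½ * (f (outside ∷ v) - f (inside ∷ v)) +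
    ½ * (∑ (down v) (f ∘ (inside ∷_)) - ∑ (up v) (f ∘ (inside ∷_)) + (ν n - (ν ∣ v ∣ + ν ∣ v ∣)) * f (inside ∷ v))
      ≈⟨ solve 7 (λ h x y l u n k → h :* (x :- y) :+ h :* (l :- u :+ (n :- (k :+ k)) :* y) :=
           h :* (x :+ l :- u :+ (con (ℤ.+ 1) :+ n :- (con (ℤ.+ 1) :+ k :+ (con (ℤ.+ 1) :+ k))) :* y))
                refl _ _ _ _ _ (ν n) (ν ∣ v ∣) ⟩
    ½ * (f (outside ∷ v) + ∑ (down v) (f ∘ (inside ∷_)) - ∑ (up v) (f ∘ (inside ∷_)) + (ν (suc n) - (ν (suc ∣ v ∣) + ν (suc ∣ v ∣))) * f (inside ∷ v))
      ≈⟨ *-congˡ (+-congʳ (+-cong (∑-down-inside v f) (-‿cong (∑-up-inside v f)))) ⟨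
    ½ * (∑ (down (inside ∷ v)) f - ∑ (up (inside ∷ v)) f + (ν (suc n) - (ν (suc ∣ v ∣) + ν (suc ∣ v ∣))) * f (inside ∷ v)) ∎

  -- Sums over the sets of a given size

  layer : ℕ → Fun n → Carrier
  layer {n} k f = ∑ (cube n) (λ S → [ ∣ S ∣ ℕ.≟ k ] * f S)

  layer-cong : ∀ k {f g : Fun n} → (∀ S → ∣ S ∣ ≡ k → f S ≈ g S) → layer k f ≈ layer k g
  layer-cong {n} k f≈g = ∑-cong (cube n) (λ S → []-cong (∣ S ∣ ℕ.≟ k) (f≈g S))

  layer-+ : ∀ k (f g : Fun n) → layer k (λ S → f S + g S) ≈ layer k f + layer k g
  layer-+ {n} k f g = trans (∑-cong (cube n) (λ S → distribˡ _ _ _)) (∑-+ (cube n) _ _)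

  layer-*ˡ : ∀ k a (f : Fun n) → layer k (λ S → a * f S) ≈ a * layer k f
  layer-*ˡ {n} k a f = trans
    (∑-cong (cube n) (λ S → solve 3 (λ p a x → p :* (a :* x) := a :* (p :* x)) refl _ _ _))
    (∑-*ˡ (cube n) a _)

  layer≈0 : ∀ k {f : Fun n} → (∀ S → ∣ S ∣ ≡ k → f S ≈ 0#) → layer k f ≈ 0#
  layer≈0 {n} k f≈0 = trans (layer-cong {n} k f≈0)
    (trans (∑-cong (cube n) (λ S → zeroʳ _)) (∑-zero (cube n)))

  layer-down-up : ∀ k (f g : Fun n) →
    layer (suc k) (λ J → f J * ∑ (down J) g) ≈ layer k (λ I → ∑ (up I) f * g I)
  layer-down-up {n} k f g = begin
    layer (suc k) (λ J → f J * ∑ (down J) g)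
      ≈⟨ ∑-cong (cube n) (λ J → *-assoc _ _ _) ⟨
    ∑ (cube n) (λ J → [ ∣ J ∣ ℕ.≟ suc k ] * f J * ∑ (down J) g)
      -- The weights match because comparing `suc ∣ I ∣` with `suc k` reduces to comparing `∣ I ∣`
      -- with `k`.
      ≈⟨ ∑-down-up (λ j → [ j ℕ.≟ suc k ]) f g ⟩
    ∑ (cube n) (λ I → [ ∣ I ∣ ℕ.≟ k ] * ∑ (up I) f * g I)
      ≈⟨ ∑-cong (cube n) (λ I → *-assoc _ _ _) ⟩
    layer k (λ I → ∑ (up I) f * g I) ∎

  -- Each set of size k + 1 lies above exactly k + 1 sets of size k. This is adjointness against the
  -- constant 1.
  layer-suc : ∀ k (f : Fun n) → ν (suc k) * layer (suc k) f ≈ layer k (λ I → ∑ (up I) f)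
  layer-suc {n} k f = begin
    ν (suc k) * layer (suc k) f                          ≈⟨ layer-*ˡ {n} (suc k) _ f ⟨
    layer (suc k) (λ J → ν (suc k) * f J)
      ≈⟨ layer-cong {n} (suc k) (λ J ∣J∣≡1+k → trans (*-comm _ _)
           (*-congˡ (trans (reflexive (≡.cong ν (≡.sym ∣J∣≡1+k))) (sym (∑-down-1 J))))) ⟩
    layer (suc k) (λ J → f J * ∑ (down J) (λ _ → 1#))    ≈⟨ layer-down-up {n} k f _ ⟩
    layer k (λ I → ∑ (up I) f * 1#)                      ≈⟨ layer-cong {n} k (λ I _ → *-identityʳ _) ⟩
    layer k (λ I → ∑ (up I) f)                           ∎

  -- Polynomials of degree d: neighbour sums and the kernel of `X̃′`.

  𝒟-∑ : ∀ {d} {Q : Fun n} ((k , _) : 𝒟 d Q) (vs : List (Subset n)) →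
    ∑ vs Q ≈ layer d (λ J → k J * ∑ vs (χ J))
  𝒟-∑ {n} {d} {Q} (k , Q≈) vs = begin
    ∑ vs Q
      ≈⟨ ∑-cong vs (λ v → trans (Q≈ v) (∑-filter (λ J → ∣ J ∣ ℕ.≟ d) (cube n) _)) ⟩
    ∑ vs (λ v → ∑ (cube n) (λ J → [ ∣ J ∣ ℕ.≟ d ] * (k J * χ J v)))
      ≈⟨ ∑-cong vs (λ v → ∑-cong (cube n) (λ J → sym (*-assoc _ _ _))) ⟩
    ∑ vs (λ v → ∑ (cube n) (λ J → [ ∣ J ∣ ℕ.≟ d ] * k J * χ J v))
      ≈⟨ ∑-swap-*ˡ vs (cube n) _ χ ⟩
    ∑ (cube n) (λ J → [ ∣ J ∣ ℕ.≟ d ] * k J * ∑ vs (χ J))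
      ≈⟨ ∑-cong (cube n) (λ J → *-assoc _ _ _) ⟩
    layer d (λ J → k J * ∑ vs (χ J)) ∎

  𝒟-eval : ∀ {d} {Q : Fun n} ((k , _) : 𝒟 d Q) → ∀ v → Q v ≈ layer d (λ J → k J * χ J v)
  𝒟-eval {n} {d} (k , Q≈) v = trans (Q≈ v) (∑-filter (λ J → ∣ J ∣ ℕ.≟ d) (cube n) _)

  𝒟-down+up : ∀ {d} {Q : Fun n} → 𝒟 d Q → ∀ v →
    ∑ (down v) Q + ∑ (up v) Q ≈ (ν n - (ν d + ν d)) * Q v
  𝒟-down+up {n} {d} {Q} Q∈𝒟@(k , _) v = begin
    ∑ (down v) Q + ∑ (up v) Q
      ≈⟨ +-cong (𝒟-∑ Q∈𝒟 (down v)) (𝒟-∑ Q∈𝒟 (up v)) ⟩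
    layer d (λ J → k J * ∑ (down v) (χ J)) + layer d (λ J → k J * ∑ (up v) (χ J))
      ≈⟨ layer-+ {n} d _ _ ⟨
    layer d (λ J → k J * ∑ (down v) (χ J) + k J * ∑ (up v) (χ J))
      ≈⟨ layer-cong {n} d (λ J ∣J∣≡d → eigen J ∣J∣≡d) ⟩
    layer d (λ J → (ν n - (ν d + ν d)) * (k J * χ J v))
      ≈⟨ layer-*ˡ {n} d _ _ ⟩
    (ν n - (ν d + ν d)) * layer d (λ J → k J * χ J v)
      ≈⟨ *-congˡ (𝒟-eval Q∈𝒟 v) ⟨
    (ν n - (ν d + ν d)) * Q v ∎
    where
    eigen : ∀ J → ∣ J ∣ ≡ d →
      k J * ∑ (down v) (χ J) + k J * ∑ (up v) (χ J) ≈ (ν n - (ν d + ν d)) * (k J * χ J v)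
    eigen J ≡.refl = begin
      k J * ∑ (down v) (χ J) + k J * ∑ (up v) (χ J)  ≈⟨ distribˡ _ _ _ ⟨
      k J * (∑ (down v) (χ J) + ∑ (up v) (χ J))      ≈⟨ *-congˡ (χ-down+up J v) ⟩
      k J * ((ν n - (ν d + ν d)) * χ J v)            ≈⟨ solve 3 (λ k a x → k :* (a :* x) :=
           a :* (k :* x)) refl _ _ _ ⟩
      (ν n - (ν d + ν d)) * (k J * χ J v)            ∎

  -- On `𝒟 d` the eigenvalue identity eliminates the upper sum from `X̃′-down-up`. Being harmonic
  -- thus becomes a condition on lower sums alone.
  𝒟-X̃′ : ∀ {d} {Q : Fun n} → 𝒟 d Q → ∀ v →
    X̃′ Q v + ν ∣ v ∣ * Q v ≈ ∑ (down v) Q + ν d * Q v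
  𝒟-X̃′ {n} {d} {Q} Q∈𝒟 v = begin
    X̃′ Q v + ν k * q
      ≈⟨ +-congʳ (X̃′-down-up Q v) ⟩
    ½ * (l - u + (ν n - (ν k + ν k)) * q) + ν k * q
      -- Writing l - u as 2l - (l + u) exposes the sum that the eigenvalue identity evaluates.
      ≈⟨ solve 6 (λ h l u n k q → h :* (l :- u :+ (n :- (k :+ k)) :* q) :+ k :* q :=
           h :* (l :+ l :- (l :+ u) :+ (n :- (k :+ k)) :* q) :+ k :* q) refl ½ l u (ν n) (ν k) q ⟩
    ½ * (l + l - (l + u) + (ν n - (ν k + ν k)) * q) + ν k * q
      ≈⟨ +-congʳ (*-congˡ (+-congʳ (+-congˡ (-‿cong (𝒟-down+up Q∈𝒟 v))))) ⟩
    ½ * (l + l - (ν n - (ν d + ν d)) * q + (ν n - (ν k + ν k)) * q) + ν k * q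
      ≈⟨ solve 6 (λ h l n k d q → h :* (l :+ l :- (n :- (d :+ d)) :* q :+ (n :- (k :+ k)) :* q) :+ k :* q :=
           h :* (con (ℤ.+ 1) :+ con (ℤ.+ 1)) :* (l :+ d :* q :- k :* q) :+ k :* q)
                refl ½ l (ν n) (ν k) (ν d) q ⟩
    ½ * (1# + 1#) * (l + ν d * q - ν k * q) + ν k * q
      ≈⟨ +-congʳ (*-congʳ ½*2≈1) ⟩
    1# * (l + ν d * q - ν k * q) + ν k * q
      ≈⟨ solve 4 (λ l d k q → con (ℤ.+ 1) :* (l :+ d :* q :- k :* q) :+ k :* q :=
           l :+ d :* q) refl l (ν d) (ν k) q ⟩
    l + ν d * q ∎
    where
    k = ∣ v ∣
    q = Q v
    l = ∑ (down v) Q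
    u = ∑ (up v) Q

  -- By symmetry of the characters this says that `X̃′` sends χ_J to the sum of the χ_{J - j} with j
  -- ∈ J. The lower sum thereby moves from the argument v to the index J.
  𝒟-X̃′-coefficients : ∀ {d} {Q : Fun n} ((k , _) : 𝒟 d Q) → ∀ v →
    X̃′ Q v ≈ layer d (λ J → k J * ∑ (down J) (χ v))
  𝒟-X̃′-coefficients {n} {d} {Q} Q∈𝒟@(k , _) v = ∙-cancelʳ (ν ∣ v ∣ * Q v) _ _ (begin
    X̃′ Q v + ν ∣ v ∣ * Q v
      ≈⟨ 𝒟-X̃′ Q∈𝒟 v ⟩
    ∑ (down v) Q + ν d * Q v
      ≈⟨ +-cong (𝒟-∑ Q∈𝒟 (down v)) (trans (*-congˡ (𝒟-eval Q∈𝒟 v)) (sym (layer-*ˡ {n} d _ _))) ⟩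
    layer d (λ J → k J * ∑ (down v) (χ J)) + layer d (λ J → ν d * (k J * χ J v))
      ≈⟨ layer-+ {n} d _ _ ⟨
    layer d (λ J → k J * ∑ (down v) (χ J) + ν d * (k J * χ J v))
      ≈⟨ layer-cong {n} d (λ J ∣J∣≡d → exchange J ∣J∣≡d) ⟩
    layer d (λ J → k J * ∑ (down J) (χ v) + ν ∣ v ∣ * (k J * χ J v))
      ≈⟨ layer-+ {n} d _ _ ⟩
    layer d (λ J → k J * ∑ (down J) (χ v)) + layer d (λ J → ν ∣ v ∣ * (k J * χ J v))
      ≈⟨ +-congˡ (trans (*-congˡ (𝒟-eval Q∈𝒟 v)) (sym (layer-*ˡ {n} d _ _))) ⟨
    layer d (λ J → k J * ∑ (down J) (χ v)) + ν ∣ v ∣ * Q v ∎)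
    where
    exchange : ∀ J → ∣ J ∣ ≡ d →
      k J * ∑ (down v) (χ J) + ν d * (k J * χ J v) ≈ k J * ∑ (down J) (χ v) + ν ∣ v ∣ * (k J * χ J v)
    exchange J ≡.refl = begin
      k J * ∑ (down v) (χ J) + ν d * (k J * χ J v)
        ≈⟨ solve 4 (λ k l d x → k :* l :+ d :* (k :* x) := k :* (l :+ d :* x)) refl _ _ _ _ ⟩
      k J * (∑ (down v) (χ J) + ν d * χ J v)
        ≈⟨ *-congˡ (χ-down-comm J v) ⟩
      k J * (∑ (down J) (χ v) + ν ∣ v ∣ * χ J v)
        ≈⟨ solve 4 (λ k l d x → k :* l :+ d :* (k :* x) := k :* (l :+ d :* x)) refl _ _ _ _ ⟨
      k J * ∑ (down J) (χ v) + ν ∣ v ∣ * (k J * χ J v) ∎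

  𝒟⁰-down : ∀ {d} {Q : Fun n} → 𝒟⁰ d Q → ∀ v → ∑ (down v) Q ≈ (ν ∣ v ∣ - ν d) * Q v
  𝒟⁰-down {d = d} {Q} (Q∈𝒟 , X̃′Q≈0) v = begin
    ∑ (down v) Q
      ≈⟨ solve 3 (λ l d q → l := l :+ d :* q :- d :* q) refl _ (ν d) (Q v) ⟩
    ∑ (down v) Q + ν d * Q v - ν d * Q v
      ≈⟨ +-congʳ (𝒟-X̃′ Q∈𝒟 v) ⟨
    X̃′ Q v + ν ∣ v ∣ * Q v - ν d * Q v
      ≈⟨ +-congʳ (+-congʳ (X̃′Q≈0 v)) ⟩
    0# + ν ∣ v ∣ * Q v - ν d * Q v
      ≈⟨ solve 3 (λ k d q → con (ℤ.+ 0) :+ k :* q :- d :* q := (k :- d) :* q) refl _ _ _ ⟩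
    (ν ∣ v ∣ - ν d) * Q v ∎

  -- Removing the lower sum from the eigenvalue identity leaves n - 2d - (∣v∣ - d).
  𝒟⁰-up : ∀ {d} {Q : Fun n} → 𝒟⁰ d Q → ∀ v → ∑ (up v) Q ≈ (ν n - ν ∣ v ∣ - ν d) * Q v
  𝒟⁰-up {n} {d} {Q} Q∈𝒟⁰@(Q∈𝒟 , _) v = begin
    ∑ (up v) Q
      ≈⟨ solve 2 (λ l u → u := l :+ u :- l) refl _ _ ⟩
    ∑ (down v) Q + ∑ (up v) Q - ∑ (down v) Q
      ≈⟨ +-cong (𝒟-down+up Q∈𝒟 v) (-‿cong (𝒟⁰-down Q∈𝒟⁰ v)) ⟩
    (ν n - (ν d + ν d)) * Q v - (ν ∣ v ∣ - ν d) * Q v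
      ≈⟨ solve 4 (λ n k d q → (n :- (d :+ d)) :* q :- (k :- d) :* q :=
           (n :- k :- d) :* q) refl (ν n) _ (ν d) _ ⟩
    (ν n - ν ∣ v ∣ - ν d) * Q v ∎

  -- Incidence

  -- The zeta function of the inclusion order with values in the field, by recursion so that
  -- inductions can split off the first element.
  sub : Subset n → Subset n → Carrier
  sub []            []            = 1#
  sub (outside ∷ S) (_ ∷ v)       = sub S v
  sub (inside  ∷ S) (inside ∷ v)  = sub S v
  sub (inside  ∷ S) (outside ∷ v) = 0#

  [⊆?]≡sub : (S v : Subset n) → [ S ⊆? v ] ≡ sub S v
  [⊆?]≡sub []            []            = ≡.refl
  [⊆?]≡sub (outside ∷ S) (_ ∷ v)       = [⊆?]≡sub S v
  [⊆?]≡sub (inside  ∷ S) (inside ∷ v)  = [⊆?]≡sub S v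
  [⊆?]≡sub (inside  ∷ S) (outside ∷ v) = ≡.refl

  -- The factor vanishes unless S ⊆ v. The detour through `_⊆?_` recovers a proof of that inclusion.
  sub-cong : (S v : Subset n) → ∀ {x y} → (∣ S ∣ ≤ ∣ v ∣ → x ≈ y) → sub S v * x ≈ sub S v * y
  sub-cong S v {x} {y} x≈y = ≡.subst (λ s → s * x ≈ s * y) ([⊆?]≡sub S v)
    ([]-cong (S ⊆? v) (x≈y ∘ p⊆q⇒∣p∣≤∣q∣))

  -- If S ⊆ v, the extensions of S inside v correspond to the ∣v∣ - ∣S∣ elements of v outside S.
  -- Otherwise none exists.
  sub-up : (S v : Subset n) → ∑ (up S) (λ T → sub T v) ≈ (ν (wt v) - ν (wt S)) * sub S v
  sub-up [] [] = solve 0 (con (ℤ.+ 0) := (con (ℤ.+ 0) :- con (ℤ.+ 0)) :* con (ℤ.+ 1)) refl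
  sub-up (outside ∷ S) (outside ∷ v) = begin
    ∑ (up (outside ∷ S)) (λ T → sub T (outside ∷ v))   ≈⟨ ∑-up-outside S _ ⟩
    0# + ∑ (up S) (λ T → sub T v)                      ≈⟨ +-identityˡ _ ⟩
    ∑ (up S) (λ T → sub T v)                           ≈⟨ sub-up S v ⟩
    (ν (wt v) - ν (wt S)) * sub S v                      ∎
  sub-up (outside ∷ S) (inside ∷ v) = begin
    ∑ (up (outside ∷ S)) (λ T → sub T (inside ∷ v))    ≈⟨ ∑-up-outside S _ ⟩
    sub S v + ∑ (up S) (λ T → sub T v)                 ≈⟨ +-congˡ (sub-up S v) ⟩
    sub S v + (ν (wt v) - ν (wt S)) * sub S v
      ≈⟨ solve 3 (λ x k s → x :+ (k :- s) :* x := (con (ℤ.+ 1) :+ k :- s) :* x) refl _ _ _ ⟩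
    (ν (suc ∣ v ∣) - ν ∣ S ∣) * sub S v                ∎
  sub-up (inside ∷ S) (outside ∷ v) = begin
    ∑ (up (inside ∷ S)) (λ T → sub T (outside ∷ v))    ≈⟨ ∑-up-inside S _ ⟩
    ∑ (up S) (λ _ → 0#)                                ≈⟨ ∑-zero (up S) ⟩
    0#                                                 ≈⟨ zeroʳ _ ⟨
    (ν ∣ v ∣ - ν (suc ∣ S ∣)) * 0#                     ∎
  sub-up (inside ∷ S) (inside ∷ v) = begin
    ∑ (up (inside ∷ S)) (λ T → sub T (inside ∷ v))     ≈⟨ ∑-up-inside S _ ⟩
    ∑ (up S) (λ T → sub T v)                           ≈⟨ sub-up S v ⟩
    (ν (wt v) - ν (wt S)) * sub S v
      ≈⟨ solve 3 (λ x k s → (k :- s) :* x := (con (ℤ.+ 1) :+ k :- (con (ℤ.+ 1) :+ s)) :* x) refl _ _ _ ⟩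
    (ν (suc ∣ v ∣) - ν (suc ∣ S ∣)) * sub S v          ∎

  -- The only subset of v with as many elements as v is v itself.
  layer-sub : (v : Subset n) (f : Fun n) → layer (wt v) (λ S → sub S v * f S) ≈ f v
  layer-sub [] f = solve 1 (λ x → con (ℤ.+ 1) :* (con (ℤ.+ 1) :* x) :+ con (ℤ.+ 0) := x) refl (f [])
  layer-sub {suc n} (outside ∷ v) f = begin
    layer (wt v) (λ S → sub S (outside ∷ v) * f S)
      ≈⟨ ∑-cube {n} _ ⟩
    layer (wt v) (λ S → sub S v * f (outside ∷ S)) +
    ∑ (cube n) (λ S → [ suc ∣ S ∣ ℕ.≟ ∣ v ∣ ] * (0# * f (inside ∷ S)))
      ≈⟨ +-cong (layer-sub v (f ∘ (outside ∷_)))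
           (trans (∑-cong (cube n) (λ S → trans (*-congˡ (zeroˡ _)) (zeroʳ _))) (∑-zero (cube n))) ⟩
    f (outside ∷ v) + 0#
      ≈⟨ +-identityʳ _ ⟩
    f (outside ∷ v) ∎
  layer-sub {suc n} (inside ∷ v) f = begin
    layer (suc (wt v)) (λ S → sub S (inside ∷ v) * f S)
      ≈⟨ ∑-cube {n} _ ⟩
    layer (suc (wt v)) (λ S → sub S v * f (outside ∷ S)) +
    layer (wt v) (λ S → sub S v * f (inside ∷ S))
      -- A set of size 1 + ∣v∣ is too large to lie in v, so the outside half vanishes.
      ≈⟨ +-cong (layer≈0 {n} (suc ∣ v ∣) (λ S ∣S∣≡1+∣v∣ → trans
           (sub-cong S v (λ ∣S∣≤∣v∣ → contradiction (ℕ.≤-trans (ℕ.≤-reflexive (≡.sym ∣S∣≡1+∣v∣)) ∣S∣≤∣v∣) (ℕ.<-irrefl ≡.refl)))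
           (zeroʳ _)))
         (layer-sub v (f ∘ (inside ∷_))) ⟩
    0# + f (inside ∷ v)
      ≈⟨ +-identityˡ _ ⟩
    f (inside ∷ v) ∎

  -- Designs annihilate harmonic polynomials

  -- Nothing lies below the empty set, so `𝒟⁰-down` reads 0 = -(d + 1) Q(v) there.
  𝒟⁰-empty : ∀ {d} {Q : Fun n} → 𝒟⁰ (suc d) Q → ∀ v → ∣ v ∣ ≡ 0 → Q v ≈ 0#
  𝒟⁰-empty {d = d} {Q} Q∈𝒟⁰ v ∣v∣≡0 = ν-cancel d (begin
    ν (suc d) * Q v               ≈⟨ solve 2 (λ d q → d :* q := :- ((con (ℤ.+ 0) :- d) :* q)) refl _ _ ⟩
    - ((ν 0 - ν (suc d)) * Q v)     ≡⟨ ≡.cong (λ k → - ((ν k - ν (suc d)) * Q v)) ∣v∣≡0 ⟨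
    - ((ν ∣ v ∣ - ν (suc d)) * Q v) ≈⟨ -‿cong (𝒟⁰-down Q∈𝒟⁰ v) ⟨
    - ∑ (down v) Q
         -- The condition on the sets below v is vacuous, so the constant may be taken to be `0#`.
         ≈⟨ -‿cong (∑-down-const v (λ _ eq → contradiction (≡.trans eq ∣v∣≡0) λ ())) ⟩
    - (ν ∣ v ∣ * 0#)              ≈⟨ solve 1 (λ k → :- (k :* con (ℤ.+ 0)) := con (ℤ.+ 0)) refl _ ⟩
    0#                            ∎)

  -- Induction on k: `layer-suc` and `𝒟⁰-up` express k + 1 times each layer sum as a multiple of the
  -- previous one.
  𝒟⁰-layer : ∀ {d} {Q : Fun n} → 𝒟⁰ (suc d) Q → ∀ k → layer k Q ≈ 0#
  𝒟⁰-layer {n} Q∈𝒟⁰ zero = layer≈0 {n} zero (𝒟⁰-empty Q∈𝒟⁰)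
  𝒟⁰-layer {n} {d} {Q} Q∈𝒟⁰ (suc k) = ν-cancel k (begin
    ν (suc k) * layer (suc k) Q
      ≈⟨ layer-suc {n} k Q ⟩
    layer k (λ I → ∑ (up I) Q)
      ≈⟨ layer-cong {n} k (λ I ∣I∣≡k →
           ≡.subst (λ k → _ ≈ (ν n - ν k - ν (suc d)) * Q I) ∣I∣≡k (𝒟⁰-up Q∈𝒟⁰ I)) ⟩
    layer k (λ I → (ν n - ν k - ν (suc d)) * Q I)
      ≈⟨ layer-*ˡ {n} k _ Q ⟩
    (ν n - ν k - ν (suc d)) * layer k Q
      ≈⟨ *-congˡ (𝒟⁰-layer Q∈𝒟⁰ k) ⟩
    (ν n - ν k - ν (suc d)) * 0#
      ≈⟨ zeroʳ _ ⟩
    0# ∎)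

  -- The count N(S) as an element of the field.
  covers : List (Subset n) → Subset n → Carrier
  covers D S = ∑ D (sub S)

  ν-length-covers : (D : List (Subset n)) (S : Subset n) →
    ν (length (filter (S ⊆?_) D)) ≈ covers D S
  ν-length-covers D S = trans (ν-length-filter (S ⊆?_) D)
    (∑-cong D (λ v → reflexive ([⊆?]≡sub S v)))

  module _ {n w} {D : List (𝔽₂^ n)} (D⊆σ : All (σ w) D) where

    covers-up : ∀ S → ∑ (up S) (covers D) ≈ (ν w - ν ∣ S ∣) * covers D S
    covers-up S = begin
      ∑ (up S) (λ T → ∑ D (sub T))
        ≈⟨ ∑-swap (up S) D sub ⟩
      ∑ D (λ v → ∑ (up S) (λ T → sub T v))
        ≈⟨ ∑-congAll (All.map (λ { {v} ≡.refl → sub-up S v }) D⊆σ) ⟩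
      ∑ D (λ v → (ν w - ν ∣ S ∣) * sub S v)
        ≈⟨ ∑-*ˡ D _ (sub S) ⟩
      (ν w - ν ∣ S ∣) * covers D S ∎

    -- After exchanging the sums, each block v meets only S = v at level w. For f = Q this
    -- identifies A_w.
    layer-covers : (f : Fun n) → layer w (λ S → covers D S * f S) ≈ ∑ D f
    layer-covers f = begin
      ∑ (cube n) (λ S → [ ∣ S ∣ ℕ.≟ w ] * (∑ D (sub S) * f S))
        ≈⟨ ∑-cong (cube n) (λ S → solve 3 (λ k s x → k :* (s :* x) := (k :* x) :* s) refl _ _ _) ⟩
      ∑ (cube n) (λ S → [ ∣ S ∣ ℕ.≟ w ] * f S * ∑ D (sub S))
        ≈⟨ ∑-swap-*ˡ D (cube n) _ sub ⟨
      ∑ D (λ v → ∑ (cube n) (λ S → [ ∣ S ∣ ℕ.≟ w ] * f S * sub S v))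
        ≈⟨ ∑-cong D (λ v → ∑-cong (cube n) (λ S → solve 3 (λ k s x → k :* (s :* x) :=
             (k :* x) :* s) refl _ _ _)) ⟨
      ∑ D (λ v → layer w (λ S → sub S v * f S))
        ≈⟨ ∑-congAll (All.map (λ { {v} ≡.refl → layer-sub v f }) D⊆σ) ⟩
      ∑ D f ∎

    module _ {d} {Q : Fun n} (Q∈𝒟⁰ : 𝒟⁰ (suc d) Q) where

      -- The numbers A_k.
      paired : ℕ → Carrier
      paired k = layer k (λ S → covers D S * Q S)

      -- `𝒟⁰-down` turns the left factor into a lower sum of Q, adjointness turns that into an upper
      -- sum of `covers D`, and `covers-up` evaluates it.
      paired-suc : ∀ k → (ν (suc k) - ν (suc d)) * paired (suc k) ≈ (ν w - ν k) * paired k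
      paired-suc k = begin
        (ν (suc k) - ν (suc d)) * paired (suc k)
          ≈⟨ layer-*ˡ {n} (suc k) _ _ ⟨
        layer (suc k) (λ S → (ν (suc k) - ν (suc d)) * (covers D S * Q S))
          ≈⟨ layer-cong {n} (suc k) (λ S ∣S∣≡1+k → trans
               (solve 3 (λ a x y → a :* (x :* y) := x :* (a :* y)) refl _ _ _)
               (*-congˡ (trans (*-congʳ (+-congʳ (reflexive (≡.cong ν (≡.sym ∣S∣≡1+k))))) (sym (𝒟⁰-down Q∈𝒟⁰ S))))) ⟩
        layer (suc k) (λ S → covers D S * ∑ (down S) Q)
          ≈⟨ layer-down-up {n} k _ _ ⟩
        layer k (λ S → ∑ (up S) (covers D) * Q S)
          ≈⟨ layer-cong {n} k (λ S ∣S∣≡k → trans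
               (*-congʳ (≡.subst (λ k → _ ≈ (ν w - ν k) * covers D S) ∣S∣≡k (covers-up S))) (*-assoc _ _ _)) ⟩
        layer k (λ S → (ν w - ν k) * (covers D S * Q S))
          ≈⟨ layer-*ˡ {n} k _ _ ⟩
        (ν w - ν k) * paired k ∎

      paired≈0 : ∀ t → suc d ≤ t → paired t ≈ 0# → ∀ i → paired (i ℕ.+ t) ≈ 0#
      paired≈0 t d<t paired≈0ₜ zero    = paired≈0ₜ
      -- The left factor of `paired-suc` at level i + t is i + t - d, which is the positive number o
      -- + 1.
      paired≈0 t d<t paired≈0ₜ (suc i) with ℕ.m≤n⇒∃[o]m+o≡n (ℕ.≤-trans d<t (ℕ.m≤n+m t i))
      ... | o , d+o≡i+t = ν-cancel o (begin
        ν (suc o) * paired (suc (i ℕ.+ t))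
          ≈⟨ *-congʳ (ν-∸ (suc d) (suc o) (≡.trans (ℕ.+-suc (suc d) o) (≡.cong suc d+o≡i+t))) ⟩
        (ν (suc (i ℕ.+ t)) - ν (suc d)) * paired (suc (i ℕ.+ t))
          ≈⟨ paired-suc (i ℕ.+ t) ⟩
        (ν w - ν (i ℕ.+ t)) * paired (i ℕ.+ t)
          ≈⟨ *-congˡ (paired≈0 t d<t paired≈0ₜ i) ⟩
        (ν w - ν (i ℕ.+ t)) * 0#
          ≈⟨ zeroʳ _ ⟩
        0# ∎)

      design⇒∑≈0 : ∀ {t} → suc d ≤ t → t ≤ w → IsTDesign t n w D → ∑ D Q ≈ 0#
      design⇒∑≈0 {t} d<t t≤w (lam , design) = begin
        ∑ D Q                    ≈⟨ layer-covers Q ⟨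
        -- The recurrence runs upwards from level t, and t ≤ w lets it reach w.
        paired w                 ≡⟨ ≡.cong paired (ℕ.m∸n+n≡m t≤w) ⟨
        paired (w ℕ.∸ t ℕ.+ t)   ≈⟨ paired≈0 t d<t pairedₜ≈0 (w ℕ.∸ t) ⟩
        0#                       ∎
        where
        pairedₜ≈0 : paired t ≈ 0#
        pairedₜ≈0 = begin
          layer t (λ S → covers D S * Q S)
            ≈⟨ layer-cong {n} t (λ S ∣S∣≡t → *-congʳ (trans (sym (ν-length-covers D S))
                 (reflexive (≡.cong ν (IsDesign.balanced design S ∣S∣≡t))))) ⟩
          layer t (λ S → ν lam * Q S)   ≈⟨ layer-*ˡ {n} t _ Q ⟩
          ν lam * layer t Q             ≈⟨ *-congˡ (𝒟⁰-layer Q∈𝒟⁰ t) ⟩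
          ν lam * 0#                    ≈⟨ zeroʳ _ ⟩
          0#                            ∎

  -- Integral elements

  -- In a field such as ℂ a vanishing sum of squares can have nonzero terms. For integers in
  -- characteristic zero it cannot, so integrality replaces an order or a conjugation.
  Integral : Carrier → Set ℓ₁
  Integral x = ∃[ i ] x ≈ ι i

  ν-integral : ∀ k → Integral (ν k)
  ν-integral k = ℤ.+ k , ×ᵤ≈× k 1#

  +-integral : ∀ {x y} → Integral x → Integral y → Integral (x + y)
  +-integral (i , x≈i) (j , y≈j) = i ℤ.+ j , trans (+-cong x≈i y≈j) (sym (ι-+ i j))

  *-integral : ∀ {x y} → Integral x → Integral y → Integral (x * y)
  *-integral (i , x≈i) (j , y≈j) = i ℤ.* j , trans (*-cong x≈i y≈j) (sym (ι-* i j))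

  -‿integral : ∀ {x} → Integral x → Integral (- x)
  -‿integral (i , x≈i) = ℤ.- i , trans (-‿cong x≈i) (sym (ι-neg i))

  1-integral : Integral 1#
  1-integral = ℤ.+ 1 , refl

  ∑-integral : (xs : List A) {f : A → Carrier} → (∀ x → Integral (f x)) → Integral (∑ xs f)
  ∑-integral []       f-int = ν-integral 0
  ∑-integral (x ∷ xs) f-int = +-integral (f-int x) (∑-integral xs f-int)

  ∏-integral : (xs : List A) {f : A → Carrier} → (∀ x → Integral (f x)) → Integral (∏ xs f)
  ∏-integral []       f-int = 1-integral
  ∏-integral (x ∷ xs) f-int = *-integral (f-int x) (∏-integral xs f-int)

  χ-integral : (J v : Subset n) → Integral (χ J v)
  χ-integral {n} J v = ∏-integral (filter (_∈? J) (allFin n)) (λ j → sign (lookup v j))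
    where
    sign : ∀ b → Integral (-1^ b)
    sign true  = -‿integral 1-integral
    sign false = 1-integral

  -- Vanishing sums of natural numbers and of integer squares.

  Natural : Carrier → Set ℓ₁
  Natural x = ∃[ k ] x ≈ ν k

  +-natural : ∀ {x y} → Natural x → Natural y → Natural (x + y)
  +-natural (j , x≈j) (k , y≈k) = j ℕ.+ k , trans (+-cong x≈j y≈k) (sym (×-homo-+ 1# j k))

  -- Characteristic zero carries the equation back to ℕ, where positivity settles it.
  natural-sum≈0 : ∀ {x y} → Natural x → Natural y → x + y ≈ 0# → x ≈ 0# × y ≈ 0#
  natural-sum≈0 (j , x≈j) (k , y≈k) x+y≈0 =
    trans x≈j (reflexive (≡.cong ν (ℕ.m+n≡0⇒m≡0 j j+k≡0))) ,
    trans y≈k (reflexive (≡.cong ν (ℕ.m+n≡0⇒n≡0 j j+k≡0)))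
    where
    j+k≡0 : j ℕ.+ k ≡ 0
    j+k≡0 = ν≈0⇒≡0 (j ℕ.+ k) (trans (×-homo-+ 1# j k) (trans (sym (+-cong x≈j y≈k)) x+y≈0))

  ∑-natural : (xs : List A) {f : A → Carrier} → (∀ x → Natural (f x)) → Natural (∑ xs f)
  ∑-natural []       f-nat = 0 , refl
  ∑-natural (x ∷ xs) f-nat = +-natural (f-nat x) (∑-natural xs f-nat)

  ∑-cube≈0 : {f : Fun n} → (∀ v → Natural (f v)) → ∑ (cube n) f ≈ 0# → ∀ v → f v ≈ 0#
  ∑-cube≈0 f-nat ∑≈0 [] = trans (sym (+-identityʳ _)) ∑≈0
  ∑-cube≈0 {suc n} {f} f-nat ∑≈0 (b ∷ v) = half b
    where
    halves : ∑ (cube n) (f ∘ (outside ∷_)) ≈ 0# × ∑ (cube n) (f ∘ (inside ∷_)) ≈ 0#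
    halves = natural-sum≈0 (∑-natural (cube n) (λ u → f-nat (outside ∷ u)))
                           (∑-natural (cube n) (λ u → f-nat (inside ∷ u)))
                           (trans (sym (∑-cube {n} f)) ∑≈0)
    half : ∀ b → f (b ∷ v) ≈ 0#
    half false = ∑-cube≈0 (λ u → f-nat (outside ∷ u)) (proj₁ halves) v
    half true  = ∑-cube≈0 (λ u → f-nat (inside ∷ u)) (proj₂ halves) v

  ν-* : ∀ j k → ν j * ν k ≈ ν (j ℕ.* k)
  ν-* j k = sym (×1-homo-* j k)

  -- Here k is the absolute value. It presents the square as a natural number and still detects the
  -- vanishing of x.
  square : ∀ {x} → Integral x → ∃[ k ] x * x ≈ ν (k ℕ.* k) × (k ≡ 0 → x ≈ 0#)
  square {x} (ℤ.+ k , x≈k) =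
    k , trans (*-cong x≈νk x≈νk) (ν-* k k) , λ { ≡.refl → x≈νk }
    where
    x≈νk : x ≈ ν k
    x≈νk = trans x≈k (sym (×ᵤ≈× k 1#))
  square {x} (-[1+ k ] , x≈-k) =
    suc k , trans (*-cong x≈-νk x≈-νk)
      (trans (solve 1 (λ y → (:- y) :* (:- y) := y :* y) refl (ν (suc k))) (ν-* (suc k) (suc k))) , λ ()
    where
    x≈-νk : x ≈ - ν (suc k)
    x≈-νk = trans x≈-k (-‿cong (sym (×ᵤ≈× (suc k) 1#)))

  square≈0 : ∀ {x} → Integral x → x * x ≈ 0# → x ≈ 0#
  square≈0 x-int x²≈0 with square x-int
  ... | k , x²≈k² , k≡0⇒x≈0 = k≡0⇒x≈0
    (Sum.reduce (ℕ.m*n≡0⇒m≡0∨n≡0 k (ν≈0⇒≡0 (k ℕ.* k) (trans (sym x²≈k²) x²≈0))))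

  []-natural : ∀ {p} {P : Set p} (P? : Dec P) {x} → Natural x → Natural ([ P? ] * x)
  []-natural (yes _) (k , x≈k) = k , trans (*-identityˡ _) x≈k
  []-natural (no _)  _         = 0 , zeroˡ _

  []*x≈0 : ∀ {p} {P : Set p} (P? : Dec P) {x} → P → [ P? ] * x ≈ 0# → x ≈ 0#
  []*x≈0 (yes _) _ x≈0 = trans (sym (*-identityˡ _)) x≈0
  []*x≈0 (no ¬p) p _   = contradiction p ¬p

  layer-square≈0 : ∀ k {f : Fun n} → (∀ S → Integral (f S)) →
    layer k (λ S → f S * f S) ≈ 0# → ∀ S → ∣ S ∣ ≡ k → f S ≈ 0#
  layer-square≈0 k f-int ∑f²≈0 S ∣S∣≡k = square≈0 (f-int S)
    ([]*x≈0 (∣ S ∣ ℕ.≟ k) ∣S∣≡k (∑-cube≈0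
      (λ T → []-natural (∣ T ∣ ℕ.≟ k) (let j , f²≈j² , _ = square (f-int T) in j ℕ.* j , f²≈j²))
      ∑f²≈0 S))

  -- Brings equalities between block counts from the field back to ℕ.
  ν-injective : ∀ j k → ν j ≈ ν k → j ≡ k
  ν-injective zero    k       ν≈ = ≡.sym (ν≈0⇒≡0 k (sym ν≈))
  ν-injective (suc j) zero    ν≈ = ν≈0⇒≡0 (suc j) ν≈
  ν-injective (suc j) (suc k) ν≈ = ≡.cong suc (ν-injective j k (∙-cancelˡ 1# _ _ ν≈))

  -- Orthogonality to harmonic polynomials forces character sums to be constant

  -- The function M, which is the Fourier transform of the indicator of D.
  characterSum : List (𝔽₂^ n) → Subset n → Carrier
  characterSum D J = ∑ D (χ J)

  -- A reference set of size k. For k > n it is the full set, and then no set of size k exists.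
  initial : ∀ n → ℕ → Subset n
  initial zero    _       = []
  initial (suc n) zero    = outside ∷ initial n zero
  initial (suc n) (suc k) = inside ∷ initial n k

  ∣initial∣ : ∀ {k} → k ≤ n → ∣ initial n k ∣ ≡ k
  ∣initial∣ {zero}  ℕ.z≤n       = ≡.refl
  ∣initial∣ {suc n} ℕ.z≤n       = ∣initial∣ {n} ℕ.z≤n
  ∣initial∣ {suc n} (ℕ.s≤s k≤n) = ≡.cong suc (∣initial∣ k≤n)

  ∣initial∣-size : ∀ {k} (S : Subset n) → ∣ S ∣ ≡ k → ∣ initial n k ∣ ≡ k
  ∣initial∣-size S ≡.refl = ∣initial∣ (∣p∣≤n S)

  initial-zero : (S : Subset n) → ∣ S ∣ ≡ 0 → S ≡ initial n 0
  initial-zero []            _     = ≡.refl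
  initial-zero (outside ∷ S) ∣S∣≡0 = ≡.cong (outside ∷_) (initial-zero S ∣S∣≡0)

  -- Comparison with one reference set names the common value, which later formulas use as a
  -- constant.
  SizeDetermined : ℕ → Fun n → Set ℓ₁
  SizeDetermined {n} k f = ∀ S → ∣ S ∣ ≡ k → f S ≈ f (initial n k)

  module _ {n w} {D : List (𝔽₂^ n)} (D⊆σ : All (σ w) D) where

    private
      M : Fun n
      M = characterSum D

    -- By symmetry of the characters, M is a sum of χ_v with ∣v∣ = w, hence an eigenfunction for the
    -- eigenvalue n - 2w.
    characterSum-down+up : ∀ I → ∑ (down I) M + ∑ (up I) M ≈ (ν n - (ν w + ν w)) * M I
    characterSum-down+up I = begin
      ∑ (down I) M + ∑ (up I) M
        ≈⟨ +-cong (transpose (down I)) (transpose (up I)) ⟩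
      ∑ D (λ v → ∑ (down I) (χ v)) + ∑ D (λ v → ∑ (up I) (χ v))
        ≈⟨ ∑-+ D _ _ ⟨
      ∑ D (λ v → ∑ (down I) (χ v) + ∑ (up I) (χ v))
        ≈⟨ ∑-congAll (All.map (λ { {v} ≡.refl → trans (χ-down+up v I) (*-congˡ (χ-comm v I)) }) D⊆σ) ⟩
      ∑ D (λ v → (ν n - (ν w + ν w)) * χ I v)
        ≈⟨ ∑-*ˡ D _ _ ⟩
      (ν n - (ν w + ν w)) * M I ∎
      where
      transpose : ∀ Js → ∑ Js M ≈ ∑ D (λ v → ∑ Js (χ v))
      transpose Js = trans (∑-swap Js D χ) (∑-cong D (λ v → ∑-cong Js (λ J → χ-comm J v)))

    module _ {d} (⊥𝒟⁰ : ∀ Q → 𝒟⁰ (suc d) Q → ∑ D Q ≈ 0#)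
             (M-d : SizeDetermined d M) (M-pred : ∀ S → suc ∣ S ∣ ≡ d → M S ≈ M (initial n (ℕ.pred d))) where

      -- There are `a` sets above a set of size d, and `C` is the sum of M over them. For d = 0 the
      -- default `ℕ.pred 0` is multiplied by `ν 0`, which is zero.
      a C : Carrier
      a = ν n - ν d
      C = (ν n - (ν w + ν w)) * M (initial n d) - ν d * M (initial n (ℕ.pred d))

      ∑-up-characterSum : ∀ I → ∣ I ∣ ≡ d → ∑ (up I) M ≈ C
      ∑-up-characterSum I ≡.refl = begin
        ∑ (up I) M
          ≈⟨ solve 2 (λ l u → u := l :+ u :- l) refl _ _ ⟩
        ∑ (down I) M + ∑ (up I) M - ∑ (down I) M
          ≈⟨ +-cong (trans (characterSum-down+up I) (*-congˡ (M-d I ≡.refl)))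
                    (-‿cong (∑-down-const I M-pred)) ⟩
        C ∎

      -- The harmonic projection of M on the sets of size d + 1, scaled to be integral.
      c₀ : Fun n
      c₀ J = a * M J + (- C) * 1#

      c₀-up : ∀ I → ∣ I ∣ ≡ d → ∑ (up I) c₀ ≈ 0#
      c₀-up I ∣I∣≡d = begin
        ∑ (up I) c₀
          ≈⟨ ∑-+ (up I) _ _ ⟩
        ∑ (up I) (λ J → a * M J) + ∑ (up I) (λ _ → (- C) * 1#)
          -- The factor `1#` in `c₀` lets `- C` be pulled out, leaving the number of sets above I.
          ≈⟨ +-cong (∑-*ˡ (up I) a M) (∑-*ˡ (up I) (- C) _) ⟩
        a * ∑ (up I) M + (- C) * ∑ (up I) (λ _ → 1#)
          ≈⟨ +-cong (*-congˡ (∑-up-characterSum I ∣I∣≡d))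
               (*-congˡ (≡.subst (λ k → _ ≈ ν n - ν k) ∣I∣≡d (∑-up-1 I))) ⟩
        a * C + (- C) * a
          ≈⟨ solve 2 (λ a c → a :* c :+ (:- c) :* a := con (ℤ.+ 0)) refl a C ⟩
        0# ∎

      c₀-integral : ∀ J → Integral (c₀ J)
      c₀-integral J = +-integral
        (*-integral (+-integral (ν-integral n) (-‿integral (ν-integral d))) (M-integral J))
        (*-integral (-‿integral C-integral) 1-integral)
        where
        M-integral : ∀ J → Integral (M J)
        M-integral J = ∑-integral D (χ-integral J)
        C-integral : Integral C
        C-integral = +-integral
          (*-integral (+-integral (ν-integral n) (-‿integral (+-integral (ν-integral w) (ν-integral w)))) (M-integral _))
          (-‿integral (*-integral (ν-integral d) (M-integral _)))

      Q₀ : Fun n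
      Q₀ v = ∑ (filter (λ J → ∣ J ∣ ℕ.≟ suc d) (cube n)) (λ J → c₀ J * χ J v)

      Q₀∈𝒟 : 𝒟 (suc d) Q₀
      Q₀∈𝒟 = c₀ , λ v → refl

      -- The coefficient of χ_I in `X̃′ Q₀` is the sum of `c₀` over the sets above I, which vanishes
      -- by `c₀-up`.
      Q₀∈𝒟⁰ : 𝒟⁰ (suc d) Q₀
      Q₀∈𝒟⁰ = Q₀∈𝒟 , λ v → begin
        X̃′ Q₀ v                                    ≈⟨ 𝒟-X̃′-coefficients {n} {suc d} {Q₀} Q₀∈𝒟 v ⟩
        layer (suc d) (λ J → c₀ J * ∑ (down J) (χ v)) ≈⟨ layer-down-up {n} d c₀ (χ v) ⟩
        layer d (λ I → ∑ (up I) c₀ * χ v I)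
          ≈⟨ layer≈0 {n} d (λ I ∣I∣≡d → trans (*-congʳ (c₀-up I ∣I∣≡d)) (zeroˡ _)) ⟩
        0# ∎

      layer-c₀≈0 : layer (suc d) c₀ ≈ 0#
      layer-c₀≈0 = ν-cancel d (trans (layer-suc {n} d c₀) (layer≈0 {n} d c₀-up))

      -- One factor is expanded as a M - C. Pairing `c₀` with M gives the sum of `Q₀` over D, and
      -- pairing it with a constant gives `layer-c₀≈0`.
      layer-c₀²≈0 : layer (suc d) (λ J → c₀ J * c₀ J) ≈ 0#
      layer-c₀²≈0 = begin
        layer (suc d) (λ J → c₀ J * c₀ J)
          ≈⟨ layer-cong {n} (suc d) (λ J _ →
               solve 4 (λ x a m c → x :* (a :* m :+ (:- c) :* con (ℤ.+ 1)) :=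
                    a :* (x :* m) :+ (:- c) :* x) refl (c₀ J) a (M J) C) ⟩
        layer (suc d) (λ J → a * (c₀ J * M J) + (- C) * c₀ J)
          ≈⟨ layer-+ {n} (suc d) _ _ ⟩
        layer (suc d) (λ J → a * (c₀ J * M J)) + layer (suc d) (λ J → (- C) * c₀ J)
          ≈⟨ +-cong (layer-*ˡ {n} (suc d) a _) (layer-*ˡ {n} (suc d) (- C) c₀) ⟩
        a * layer (suc d) (λ J → c₀ J * M J) + (- C) * layer (suc d) c₀
          ≈⟨ +-cong (*-congˡ (trans (sym (𝒟-∑ {n} {suc d} {Q₀} Q₀∈𝒟 D)) (⊥𝒟⁰ Q₀ Q₀∈𝒟⁰)))
               (*-congˡ layer-c₀≈0) ⟩
        a * 0# + (- C) * 0#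
          ≈⟨ solve 2 (λ a c → a :* con (ℤ.+ 0) :+ (:- c) :* con (ℤ.+ 0) := con (ℤ.+ 0)) refl a C ⟩
        0# ∎

      characterSum-suc : SizeDetermined (suc d) M
      characterSum-suc J ∣J∣≡1+d = x∙y⁻¹≈ε⇒x≈y _ _ (ν-cancel o (begin
        ν (suc o) * (M J - M J₀)
          -- A set J of size d + 1 exists, so d < n and `a` is the positive number o + 1.
          ≈⟨ *-congʳ (ν-∸ d (suc o) (≡.trans (ℕ.+-suc d o) 1+d+o≡n)) ⟩
        a * (M J - M J₀)
          ≈⟨ solve 4 (λ a m m₀ c → a :* (m :- m₀) :=
               (a :* m :+ (:- c) :* con (ℤ.+ 1)) :- (a :* m₀ :+ (:- c) :* con (ℤ.+ 1)))
               refl a (M J) (M J₀) C ⟩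
        c₀ J - c₀ J₀
          ≈⟨ +-cong (c₀≈0 J ∣J∣≡1+d) (-‿cong (c₀≈0 J₀ (∣initial∣-size J ∣J∣≡1+d))) ⟩
        0# - 0#
          ≈⟨ -‿inverseʳ 0# ⟩
        0# ∎))
        where
        J₀ = initial n (suc d)
        c₀≈0 = layer-square≈0 (suc d) c₀-integral layer-c₀²≈0
        d<n : suc d ≤ n
        d<n = ≡.subst (_≤ n) ∣J∣≡1+d (∣p∣≤n J)
        o = proj₁ (ℕ.m≤n⇒∃[o]m+o≡n d<n)
        1+d+o≡n = proj₂ (ℕ.m≤n⇒∃[o]m+o≡n d<n)

    module _ {t} (⊥𝒟⁰ : ∀ Q → (∃[ d ] 1 ≤ d × d ≤ t × 𝒟⁰ d Q) → ∑ D Q ≈ 0#) where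

      -- The step to size d + 1 uses the two preceding sizes, so the induction carries both.
      characterSum-determined : ∀ d → d ≤ t →
        SizeDetermined d M × (∀ S → suc ∣ S ∣ ≡ d → M S ≈ M (initial n (ℕ.pred d)))
      characterSum-determined zero    _   =
        (λ S ∣S∣≡0 → reflexive (≡.cong M (initial-zero S ∣S∣≡0))) , λ _ ()
      characterSum-determined (suc d) d<t with characterSum-determined d (ℕ.≤-trans (ℕ.n≤1+n d) d<t)
      ... | M-d , M-pred =
        characterSum-suc (λ Q Q∈𝒟⁰ → ⊥𝒟⁰ Q (suc d , ℕ.s≤s ℕ.z≤n , d<t , Q∈𝒟⁰)) M-d M-pred ,
        λ S 1+∣S∣≡1+d → M-d S (ℕ.suc-injective 1+∣S∣≡1+d)

  -- Inclusion counts from character sums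

  alternate 2^ : ℕ → Carrier
  alternate zero    = 1#
  alternate (suc k) = - alternate k
  2^ zero    = 1#
  2^ (suc k) = 2^ k + 2^ k

  2^-cancel : ∀ k {x} → 2^ k * x ≈ 0# → x ≈ 0#
  2^-cancel zero    x≈0 = trans (sym (*-identityˡ _)) x≈0
  2^-cancel (suc k) {x} 2ᵏx≈0 = 2^-cancel k (ν-cancel 1 (trans
    (solve 2 (λ p x → (con (ℤ.+ 1) :+ (con (ℤ.+ 1) :+ con (ℤ.+ 0))) :* (p :* x) :=
         (p :+ p) :* x) refl (2^ k) x) 2ᵏx≈0))

  -- Expands 2^∣J∣ [J ⊆ v] = ∏_{j ∈ J} (1 - (-1)^{v_j}).
  ∑-sub-χ : (J v : Subset n) →
    ∑ (cube n) (λ A → sub A J * (alternate ∣ A ∣ * χ A v)) ≈ 2^ ∣ J ∣ * sub J v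
  ∑-sub-χ [] [] = solve 0 (con (ℤ.+ 1) :* (con (ℤ.+ 1) :* con (ℤ.+ 1)) :+ con (ℤ.+ 0) :=
       con (ℤ.+ 1) :* con (ℤ.+ 1)) refl
  ∑-sub-χ {suc n} (outside ∷ J) (b ∷ v) = begin
    ∑ (cube (suc n)) (λ A → sub A (outside ∷ J) * (alternate ∣ A ∣ * χ A (b ∷ v)))
      ≈⟨ ∑-cube {n} _ ⟩
    ∑ (cube n) (λ A → sub A J * (alternate ∣ A ∣ * χ (outside ∷ A) (b ∷ v))) +
    ∑ (cube n) (λ A → 0# * (- alternate ∣ A ∣ * χ (inside ∷ A) (b ∷ v)))
      ≈⟨ +-cong (trans (∑-cong (cube n) (λ A → *-congˡ (*-congˡ (χ-outsideˡ b A v)))) (∑-sub-χ J v))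
                (trans (∑-cong (cube n) (λ A → zeroˡ _)) (∑-zero (cube n))) ⟩
    2^ ∣ J ∣ * sub J v + 0#
      ≈⟨ +-identityʳ _ ⟩
    2^ ∣ J ∣ * sub J v ∎
  ∑-sub-χ {suc n} (inside ∷ J) (outside ∷ v) = begin
    ∑ (cube (suc n)) (λ A → sub A (inside ∷ J) * (alternate ∣ A ∣ * χ A (outside ∷ v)))
      ≈⟨ ∑-cube {n} _ ⟩
    ∑ (cube n) (λ A → sub A J * (alternate ∣ A ∣ * χ (outside ∷ A) (outside ∷ v))) +
    ∑ (cube n) (λ A → sub A J * (- alternate ∣ A ∣ * χ (inside ∷ A) (outside ∷ v)))
      ≈⟨ ∑-+ (cube n) _ _ ⟨
    ∑ (cube n) (λ A → sub A J * (alternate ∣ A ∣ * χ (outside ∷ A) (outside ∷ v)) +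
                      sub A J * (- alternate ∣ A ∣ * χ (inside ∷ A) (outside ∷ v)))
      ≈⟨ ∑-cong (cube n) (λ A → trans
           (+-cong (*-congˡ (*-congˡ (χ-outsideˡ outside A v))) (*-congˡ (*-congˡ (χ-outsideʳ inside A v))))
           (solve 3 (λ s e x → s :* (e :* x) :+ s :* ((:- e) :* x) := con (ℤ.+ 0)) refl _ _ _)) ⟩
    ∑ (cube n) (λ _ → 0#)
      ≈⟨ ∑-zero (cube n) ⟩
    0#
      ≈⟨ zeroʳ _ ⟨
    2^ (suc ∣ J ∣) * 0# ∎
  ∑-sub-χ {suc n} (inside ∷ J) (inside ∷ v) = begin
    ∑ (cube (suc n)) (λ A → sub A (inside ∷ J) * (alternate ∣ A ∣ * χ A (inside ∷ v)))
      ≈⟨ ∑-cube {n} _ ⟩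
    ∑ (cube n) (λ A → sub A J * (alternate ∣ A ∣ * χ (outside ∷ A) (inside ∷ v))) +
    ∑ (cube n) (λ A → sub A J * (- alternate ∣ A ∣ * χ (inside ∷ A) (inside ∷ v)))
      ≈⟨ +-cong
           (∑-cong (cube n) (λ A → *-congˡ (*-congˡ (χ-outsideˡ inside A v))))
           (∑-cong (cube n) (λ A → *-congˡ (trans (*-congˡ (χ-inside A v))
             (solve 2 (λ e x → (:- e) :* (:- x) := e :* x) refl _ _)))) ⟩
    ∑ (cube n) (λ A → sub A J * (alternate ∣ A ∣ * χ A v)) +
    ∑ (cube n) (λ A → sub A J * (alternate ∣ A ∣ * χ A v))
      ≈⟨ +-cong (∑-sub-χ J v) (∑-sub-χ J v) ⟩
    2^ ∣ J ∣ * sub J v + 2^ ∣ J ∣ * sub J v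
      ≈⟨ distribʳ _ _ _ ⟨
    2^ (suc ∣ J ∣) * sub J v ∎

  ∑-sub-characterSum : (D : List (𝔽₂^ n)) (J : Subset n) →
    ∑ (cube n) (λ A → sub A J * (alternate ∣ A ∣ * characterSum D A)) ≈ 2^ ∣ J ∣ * covers D J
  ∑-sub-characterSum {n} D J = begin
    ∑ (cube n) (λ A → sub A J * (alternate ∣ A ∣ * ∑ D (χ A)))
      ≈⟨ ∑-cong (cube n) (λ A → *-assoc _ _ _) ⟨
    ∑ (cube n) (λ A → sub A J * alternate ∣ A ∣ * ∑ D (χ A))
      ≈⟨ ∑-swap-*ˡ D (cube n) _ χ ⟨
    ∑ D (λ v → ∑ (cube n) (λ A → sub A J * alternate ∣ A ∣ * χ A v))
      ≈⟨ ∑-cong D (λ v → trans (∑-cong (cube n) (λ A → *-assoc _ _ _)) (∑-sub-χ J v)) ⟩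
    ∑ D (λ v → 2^ ∣ J ∣ * sub J v)
      ≈⟨ ∑-*ˡ D _ _ ⟩
    2^ ∣ J ∣ * covers D J ∎

  -- The sum of binomial(k, i) g(i) over i, unfolded by Pascal's rule to match the splitting of
  -- subsets by one element.
  binomialSum : (ℕ → Carrier) → ℕ → Carrier
  binomialSum g zero    = g zero
  binomialSum g (suc k) = binomialSum g k + binomialSum (g ∘ suc) k

  ∑-sub-size : (g : ℕ → Carrier) (J : Subset n) →
    ∑ (cube n) (λ A → sub A J * g ∣ A ∣) ≈ binomialSum g ∣ J ∣
  ∑-sub-size g [] = solve 1 (λ x → con (ℤ.+ 1) :* x :+ con (ℤ.+ 0) := x) refl (g 0)
  ∑-sub-size {suc n} g (outside ∷ J) = begin
    ∑ (cube (suc n)) (λ A → sub A (outside ∷ J) * g ∣ A ∣)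
      ≈⟨ ∑-cube {n} _ ⟩
    ∑ (cube n) (λ A → sub A J * g ∣ A ∣) + ∑ (cube n) (λ A → 0# * g (suc ∣ A ∣))
      ≈⟨ +-cong (∑-sub-size g J) (trans (∑-cong (cube n) (λ A → zeroˡ _)) (∑-zero (cube n))) ⟩
    binomialSum g ∣ J ∣ + 0#
      ≈⟨ +-identityʳ _ ⟩
    binomialSum g ∣ J ∣ ∎
  ∑-sub-size {suc n} g (inside ∷ J) =
    trans (∑-cube {n} _) (+-cong (∑-sub-size g J) (∑-sub-size (g ∘ suc) J))

  covers-determined : (D : List (𝔽₂^ n)) → ∀ {t} →
    (∀ d → d ≤ t → SizeDetermined d (characterSum D)) → SizeDetermined t (covers D)
  covers-determined {n} D {t} M-determined J ∣J∣≡t = x∙y⁻¹≈ε⇒x≈y _ _ (2^-cancel t (begin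
    2^ t * (covers D J - covers D (initial n t))
      ≈⟨ solve 3 (λ p x y → p :* (x :- y) := p :* x :- p :* y) refl _ _ _ ⟩
    2^ t * covers D J - 2^ t * covers D (initial n t)
      ≈⟨ +-cong (scaled J ∣J∣≡t) (-‿cong (scaled (initial n t) (∣initial∣-size J ∣J∣≡t))) ⟩
    binomialSum g t - binomialSum g t
      ≈⟨ -‿inverseʳ _ ⟩
    0# ∎))
    where
    g : ℕ → Carrier
    g k = alternate k * characterSum D (initial n k)

    scaled : ∀ S → ∣ S ∣ ≡ t → 2^ t * covers D S ≈ binomialSum g t
    scaled S ≡.refl = begin
      2^ ∣ S ∣ * covers D S
        ≈⟨ ∑-sub-characterSum D S ⟨
      ∑ (cube n) (λ A → sub A S * (alternate ∣ A ∣ * characterSum D A))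
        -- Only A ⊆ S contribute, and their sizes are at most t, where M depends on size alone.
        ≈⟨ ∑-cong (cube n) (λ A → sub-cong A S (λ ∣A∣≤t → *-congˡ (M-determined ∣ A ∣ ∣A∣≤t A ≡.refl))) ⟩
      ∑ (cube n) (λ A → sub A S * g ∣ A ∣)
        ≈⟨ ∑-sub-size g S ⟩
      binomialSum g ∣ S ∣ ∎

  ∑≈0⇒design : ∀ {n w t} {D : List (𝔽₂^ n)} → Unique D → All (σ w) D →
    (∀ Q → (∃[ d ] 1 ≤ d × d ≤ t × 𝒟⁰ d Q) → ∑ D Q ≈ 0#) → IsTDesign t n w D
  -- The number λ is read off at the reference set of size t.
  ∑≈0⇒design {n} {w} {t} {D} unique D⊆σ ⊥𝒟⁰ = length (filter (initial n t ⊆?_) D) , record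
    { distinct = unique
    ; blocks   = D⊆σ
    ; balanced = λ S ∣S∣≡t → ν-injective _ _ (begin
        ν (length (filter (S ⊆?_) D))            ≈⟨ ν-length-covers D S ⟩
        covers D S
             ≈⟨ covers-determined D (λ d d≤t → proj₁ (characterSum-determined D⊆σ ⊥𝒟⁰ d d≤t)) S ∣S∣≡t ⟩
        covers D (initial n t)                   ≈⟨ ν-length-covers D (initial n t) ⟨
        ν (length (filter (initial n t ⊆?_) D))  ∎)
    }

proposition7p1 :
    ∀ {c ℓ₁ ℓ₂} (K : HeytingField c ℓ₁ ℓ₂) (charZero : CharZero K) →
    let open HeytingField K
        open DiscreteHarmonic K charZero
    in
    ∀ (n w t : ℕ) → 1 ≤ t → t ≤ w →
    ∀ (D : List (𝔽₂^ n)) → Unique D → All (σ w) D →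
    IsTDesign t n w D
      ⇔ (∀ (Q : Fun n) → (∃[ d ] 1 ≤ d × d ≤ t × 𝒟⁰ d Q) → ∑ D Q ≈ 0#)
proposition7p1 K charZero n w t 1≤t t≤w D unique D⊆σ = mk⇔
  -- The bound 1 ≤ d excludes degree 0, whose nonzero constants do not sum to zero over a nonempty
  -- D.
  (λ { design Q (suc d , _ , d≤t , Q∈𝒟⁰) → design⇒∑≈0 D⊆σ Q∈𝒟⁰ d≤t t≤w design })
  (∑≈0⇒design unique D⊆σ)
  where open Designs K charZero
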